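{- Let $\mathrm{st}$ be a weakly bicompatible permutation statistic. Then the comultiplication $\Delta$ of the substring coalgebra $\mathcal{C}_{\mathrm{st}}$ is a (graded) algebra homomorphism with respect to the multiplication of the shuffle algebra $\mathcal{A}_{\mathrm{st}}$; that is, on the common underlying graded vector space, $\Delta : \mathcal{A}_{\mathrm{st}} \to \mathcal{A}_{\mathrm{st}} \otimes \mathcal{A}_{\mathrm{st}}$ is a homomorphism of graded algebras.
   Context: A permutation is a finite (possibly empty) sequence $\pi = \pi_1 \cdots \pi_n$ of distinct positive integers, called its letters; $|\pi| = n$ is its length. Permutations $\pi,\sigma$ of the same length have the same relative order if $\pi_i<\pi_j \iff \sigma_i<\sigma_j$ for all $i,j$. A permutation statistic is a function $\mathrm{st}$ on all permutations that takes equal values on permutations with the same relative order. Write $\pi \sim_{\mathrm{st}} \sigma$ if $|\pi| = |\sigma|$ and $\mathrm{st}(\pi) = \mathrm{st}(\sigma)$; $[\pi]_{\mathrm{st}}$ is the equivalence class of $\pi$. For permutations with no letters in common, the shuffle set $\pi ⧢ \sigma$ is the set of all $\binom{|\pi|+|\sigma|}{|\pi|}$ permutations of length $|\pi|+|\sigma|$ containing both $\pi$ and $\sigma$ as subsequences. Write $\pi < \sigma$ if every letter of $\pi$ is strictly less than every letter of $\sigma$. $\mathrm{st}$ is weakly shuffle-compatible if whenever $\pi < \sigma$, the multiset $\{\mathrm{st}(\tau) : \tau \in \pi ⧢ \sigma\}$ depends only on $\mathrm{st}(\pi), \mathrm{st}(\sigma), |\pi|, |\sigma|$. $\mathrm{st}$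 is substring-compatible if $\pi \sim_{\mathrm{st}} \sigma$ implies $\pi_i \cdots \pi_j \sim_{\mathrm{st}} \sigma_i \cdots \sigma_j$ for all $1 \le i \le j \le |\pi|$. Weakly bicompatible means weakly shuffle-compatible and substring-compatible. The shuffle algebra $\mathcal{A}_{\mathrm{st}}$ of a weakly shuffle-compatible statistic is the graded $\mathbb{Q}$-algebra with basis the classes $[\pi]_{\mathrm{st}}$, graded by length, with product $[\pi]_{\mathrm{st}} \cdot [\sigma]_{\mathrm{st}} = \sum_{\tau \in \pi ⧢ \sigma} [\tau]_{\mathrm{st}}$, where representatives are chosen with $\pi < \sigma$ (always possible, and the result is independent of the choice); the unit is the class of the empty permutation. The substring coalgebra $\mathcal{C}_{\mathrm{st}}$ of a substring-compatible statistic is the graded $\mathbb{Q}$-coalgebra with the same basis and grading, with $\Delta([\pi]_{\mathrm{st}}) = \sum_{i=0}^{n} [\pi_1 \cdots \pi_i]_{\mathrm{st}} \otimes [\pi_{i+1} \cdots \pi_n]_{\mathrm{st}}$ for $\pi=\pi_1\cdots\pi_n$, and counit sending $[\pi]_{\mathrm{st}}$ to $1$ if $\pi$ is empty and to $0$ otherwise. -}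

module Defs where

open import Algebra.Bundles using (Ring)
open import Algebra.Bundles.Raw using (RawRing)
open import Algebra.Module.Bundles using (LeftModule)
open import Algebra.Module.Structures using (IsLeftModule)
import Algebra.Module.Morphism.Structures as ModuleMorphisms
import Algebra.Morphism.Structures as Morphisms
import Algebra.Structures as Structures
open import Data.Empty using (⊥-elim)
open import Data.Fin.Base as Fin using (Fin; cast)
open import Data.List.Base using (List; []; _∷_; [_]; _++_; map; foldr; length; lookup; take; drop; upTo; concatMap)
open import Data.List.Extrema.Nat using (max; xs≤max)
open import Data.List.Membership.Propositional using (_∈_)
open import Data.List.Membership.Propositional.Properties using (∈-map⁺; ∈-map⁻; ∈-++⁺ˡ; ∈-++⁺ʳ)
open import Data.List.Properties using (length-map; length-++; map-++; map-∘; ∷-injectiveˡ; ∷-injectiveʳ; concatMap-++; concatMap-map; map-concatMap; ++-assoc; ++-identityʳ)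
open import Data.List.Relation.Binary.Disjoint.Propositional using (Disjoint)
open import Data.List.Relation.Binary.Permutation.Propositional using (_↭_; ↭-refl; ↭-reflexive; ↭-sym; ↭-trans)
open import Data.List.Relation.Binary.Permutation.Propositional.Properties using (All-resp-↭; ↭-length; ↭-map-inv; map⁺; ++⁺; ++⁺ˡ; ++-comm)
open import Data.List.Relation.Binary.Sublist.Propositional using (_⊆_; []; _∷_; _∷ʳ_)
open import Data.List.Relation.Ternary.Interleaving.Propositional using (Interleaving; []; consˡ; consʳ; toPermutation)
open import Data.List.Relation.Unary.All as All using (All; []; _∷_)
import Data.List.Relation.Unary.All.Properties as Allₚ
open import Data.List.Relation.Unary.AllPairs using ([]; _∷_)
open import Data.List.Relation.Unary.Any using (here; there)
open import Data.List.Relation.Unary.Unique.DecPropositional using (unique?)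
open import Data.List.Relation.Unary.Unique.Propositional using (Unique)
import Data.List.Relation.Unary.Unique.Propositional.Properties as Uniqueₚ
open import Data.Nat.Base as ℕ using (ℕ; zero; suc; _<_; _≤_; _∸_; s≤s; z≤n)
import Data.Nat.Properties as ℕₚ
open import Data.Product.Base using (Σ; ∃; ∃₂; _×_; _,_; proj₁; proj₂)
open import Data.Rational.Base as ℚ using (ℚ; 0ℚ; 1ℚ)
import Data.Rational.Properties as ℚₚ
open import Function.Base using (_∘_)
open import Function.Bundles using (_⇔_; mk⇔)
open import Level using (Level; 0ℓ; _⊔_) renaming (suc to lsuc)
open import Relation.Binary.Core using (Rel)
open import Relation.Binary.PropositionalEquality using (_≡_; _≢_; refl; sym; trans; cong; cong₂; subst; subst₂)
open import Relation.Nullary using (Dec; yes; no; contradiction)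
open import Relation.Nullary.Decidable using (_×-dec_)
open import Relation.Unary using (Pred)

private
  variable
    a b h g r d c₁ ℓ₁ h₁ c₂ ℓ₂ h₂ v : Level

ℚ-ring : Ring 0ℓ 0ℓ
ℚ-ring = ℚₚ.+-*-ring

record GradedAlgebra c ℓ h : Set (lsuc (c ⊔ ℓ ⊔ h)) where
  infix  4 _≈_
  infixl 6 _+_
  infixl 7 _*_
  infixr 7 _·_
  field
    Carrier : Set c
    _≈_     : Rel Carrier ℓ
    _+_ _*_ : Carrier → Carrier → Carrier
    -_      : Carrier → Carrier
    0# 1#   : Carrier
    _·_     : ℚ → Carrier → Carrier

    isRing       : Structures.IsRing _≈_ _+_ _*_ -_ 0# 1#
    isLeftModule : IsLeftModule ℚ-ring _≈_ _+_ 0# -_ _·_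
    *-·-assocˡ   : ∀ q x y → (q · x) * y ≈ q · (x * y)
    *-·-assocʳ   : ∀ q x y → x * (q · y) ≈ q · (x * y)

    -- Homogeneous n is the degree n subspace.
    Homogeneous        : ℕ → Pred Carrier h
    homogeneous-resp-≈ : ∀ {n x y} → x ≈ y → Homogeneous n x → Homogeneous n y
    homogeneous-0      : ∀ {n} → Homogeneous n 0#
    homogeneous-+      : ∀ {n x y} → Homogeneous n x → Homogeneous n y → Homogeneous n (x + y)
    homogeneous-·      : ∀ {n} q {x} → Homogeneous n x → Homogeneous n (q · x)
    homogeneous-1      : Homogeneous 0 1#
    homogeneous-*      : ∀ {m n x y} → Homogeneous m x → Homogeneous n y → Homogeneous (m ℕ.+ n) (x * y)

    -- The algebra is the direct sum of these subspaces: they span it, and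
    -- the linear projections show that the sum is direct.
    homogeneous-spans : ∀ x → ∃ λ xs → All (λ y → ∃ λ n → Homogeneous n y) xs × x ≈ foldr _+_ 0# xs
    component         : ℕ → Carrier → Carrier
    component-cong    : ∀ n {x y} → x ≈ y → component n x ≈ component n y
    component-+       : ∀ n x y → component n (x + y) ≈ component n x + component n y
    component-·       : ∀ n q x → component n (q · x) ≈ q · component n x
    component-same    : ∀ {n x} → Homogeneous n x → component n x ≈ x
    component-other   : ∀ {m n x} → m ≢ n → Homogeneous m x → component n x ≈ 0#

  rawRing : RawRing c ℓ
  rawRing = record { _≈_ = _≈_ ; _+_ = _+_ ; _*_ = _*_ ; -_ = -_ ; 0# = 0# ; 1# = 1# }

  leftModule : LeftModule ℚ-ring c ℓ
  leftModule = record { isLeftModule = isLeftModule }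

  open LeftModule leftModule public using (rawLeftModule)
  open Structures.IsRing isRing public

record IsGradedAlgebraHomomorphism
         (A : GradedAlgebra c₁ ℓ₁ h₁) (B : GradedAlgebra c₂ ℓ₂ h₂)
         (f : GradedAlgebra.Carrier A → GradedAlgebra.Carrier B)
         : Set (c₁ ⊔ ℓ₁ ⊔ h₁ ⊔ c₂ ⊔ ℓ₂ ⊔ h₂) where
  private
    module A = GradedAlgebra A
    module B = GradedAlgebra B
  field
    isRingHomomorphism       : Morphisms.RingMorphisms.IsRingHomomorphism A.rawRing B.rawRing f
    isLeftModuleHomomorphism : ModuleMorphisms.LeftModuleMorphisms.IsLeftModuleHomomorphism
                                 A.rawLeftModule B.rawLeftModule f
    homogeneous-homo         : ∀ {n x} → A.Homogeneous n x → B.Homogeneous n (f x)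

infixl 6 _⊕_
infixr 7 _·_

-- Formal ℚ-linear combinations of generators, before imposing any equations.
data Comb (G : Set g) : Set g where
  𝟘   : Comb G
  _⊕_ : Comb G → Comb G → Comb G
  _·_ : ℚ → Comb G → Comb G
  ⟨_⟩ : G → Comb G

sum : {G : Set g} → List (Comb G) → Comb G
sum = foldr _⊕_ 𝟘

extend : {G : Set g} {H : Set h} → (G → Comb H) → Comb G → Comb H
extend f 𝟘       = 𝟘
extend f (x ⊕ y) = extend f x ⊕ extend f y
extend f (q · x) = q · extend f x
extend f ⟨ i ⟩   = f i

module Presented {G : Set g} (R : Rel (Comb G) r) where

  infix 4 _≈_

  -- The least congruence containing R for which Comb G is a ℚ-vector space.
  data _≈_ : Rel (Comb G) (g ⊔ r) where
    relation     : ∀ {x y} → R x y → x ≈ y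
    ≈-refl       : ∀ {x} → x ≈ x
    ≈-sym        : ∀ {x y} → x ≈ y → y ≈ x
    ≈-trans      : ∀ {x y z} → x ≈ y → y ≈ z → x ≈ z
    ⊕-cong       : ∀ {x x′ y y′} → x ≈ x′ → y ≈ y′ → x ⊕ y ≈ x′ ⊕ y′
    ·-cong       : ∀ q {x y} → x ≈ y → q · x ≈ q · y
    ⊕-assoc      : ∀ x y z → (x ⊕ y) ⊕ z ≈ x ⊕ (y ⊕ z)
    ⊕-comm       : ∀ x y → x ⊕ y ≈ y ⊕ x
    ⊕-identityˡ  : ∀ x → 𝟘 ⊕ x ≈ x
    ·-distribˡ   : ∀ q x y → q · (x ⊕ y) ≈ q · x ⊕ q · y
    ·-distribʳ   : ∀ x p q → (p ℚ.+ q) · x ≈ p · x ⊕ q · x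
    ·-assoc      : ∀ p q x → (p ℚ.* q) · x ≈ p · (q · x)
    ·-identity   : ∀ x → 1ℚ · x ≈ x
    ·-zeroˡ      : ∀ x → 0ℚ · x ≈ 𝟘

  ≈-reflexive : ∀ {x y} → x ≡ y → x ≈ y
  ≈-reflexive refl = ≈-refl

  ·-zeroʳ : ∀ q → q · 𝟘 ≈ 𝟘
  ·-zeroʳ q = ≈-trans (·-cong q (≈-sym (·-zeroˡ 𝟘)))
             (≈-trans (≈-sym (·-assoc q 0ℚ 𝟘))
             (≈-trans (≈-reflexive (cong (_· 𝟘) (ℚₚ.*-zeroʳ q))) (·-zeroˡ 𝟘)))

  ⊕-identityʳ : ∀ x → x ⊕ 𝟘 ≈ x
  ⊕-identityʳ x = ≈-trans (⊕-comm x 𝟘) (⊕-identityˡ x)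

  ⊖_ : Comb G → Comb G
  ⊖ x = (ℚ.- 1ℚ) · x

  ⊖-inverseʳ : ∀ x → x ⊕ ⊖ x ≈ 𝟘
  ⊖-inverseʳ x = ≈-trans (⊕-cong (≈-sym (·-identity x)) ≈-refl)
                (≈-trans (≈-sym (·-distribʳ x 1ℚ (ℚ.- 1ℚ))) (·-zeroˡ x))

  isLeftModule : IsLeftModule ℚ-ring _≈_ _⊕_ 𝟘 ⊖_ _·_
  isLeftModule = record
    { isLeftSemimodule = record
      { +ᴹ-isCommutativeMonoid = record
        { isMonoid = record
          { isSemigroup = record
            { isMagma = record
              { isEquivalence = record { refl = ≈-refl ; sym = ≈-sym ; trans = ≈-trans }
              ; ∙-cong = ⊕-cong }
            ; assoc = ⊕-assoc }
          ; identity = ⊕-identityˡ , ⊕-identityʳ }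
        ; comm = ⊕-comm }
      ; isPreleftSemimodule = record
        { *ₗ-cong = λ { {p} refl e → ·-cong p e }
        ; *ₗ-zeroˡ = ·-zeroˡ
        ; *ₗ-distribʳ = ·-distribʳ
        ; *ₗ-identityˡ = ·-identity
        ; *ₗ-assoc = ·-assoc
        ; *ₗ-zeroʳ = ·-zeroʳ
        ; *ₗ-distribˡ = ·-distribˡ } }
    ; -ᴹ‿cong = ·-cong (ℚ.- 1ℚ)
    ; -ᴹ‿inverse = (λ x → ≈-trans (⊕-comm (⊖ x) x) (⊖-inverseʳ x)) , ⊖-inverseʳ }

  data Span (P : Pred G d) : Pred (Comb G) (g ⊔ r ⊔ d) where
    generator : ∀ {i} → P i → Span P ⟨ i ⟩
    zero      : Span P 𝟘
    add       : ∀ {x y} → Span P x → Span P y → Span P (x ⊕ y)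
    scale     : ∀ q {x} → Span P x → Span P (q · x)
    resp      : ∀ {x y} → x ≈ y → Span P x → Span P y

  span-sum : ∀ {P : Pred G d} {xs} → All (Span P) xs → Span P (sum xs)
  span-sum []       = zero
  span-sum (p ∷ ps) = add p (span-sum ps)

  interchange : ∀ w x y z → (w ⊕ x) ⊕ (y ⊕ z) ≈ (w ⊕ y) ⊕ (x ⊕ z)
  interchange w x y z =
    ≈-trans (⊕-assoc w x (y ⊕ z))
   (≈-trans (⊕-cong ≈-refl (≈-trans (≈-sym (⊕-assoc x y z))
                           (≈-trans (⊕-cong (⊕-comm x y) ≈-refl) (⊕-assoc y x z))))
            (≈-sym (⊕-assoc w y (x ⊕ z))))

  sum-++ : ∀ xs ys → sum (xs ++ ys) ≈ sum xs ⊕ sum ys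
  sum-++ []       ys = ≈-sym (⊕-identityˡ _)
  sum-++ (x ∷ xs) ys = ≈-trans (⊕-cong ≈-refl (sum-++ xs ys)) (≈-sym (⊕-assoc x (sum xs) (sum ys)))

  sum-↭ : ∀ {xs ys} → xs ↭ ys → sum xs ≈ sum ys
  sum-↭ _↭_.refl          = ≈-refl
  sum-↭ (_↭_.prep x p)    = ⊕-cong ≈-refl (sum-↭ p)
  sum-↭ (_↭_.swap x y p)  = ≈-trans (⊕-cong ≈-refl (⊕-cong ≈-refl (sum-↭ p)))
                           (≈-trans (≈-sym (⊕-assoc x y _))
                           (≈-trans (⊕-cong (⊕-comm x y) ≈-refl) (⊕-assoc y x _)))
  sum-↭ (_↭_.trans p q)   = ≈-trans (sum-↭ p) (sum-↭ q)

  sum-map-cong : ∀ {I : Set a} {f f′ : I → Comb G} {is} →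
                 All (λ i → f i ≈ f′ i) is → sum (map f is) ≈ sum (map f′ is)
  sum-map-cong []       = ≈-refl
  sum-map-cong (e ∷ es) = ⊕-cong e (sum-map-cong es)

  sum-concatMap : ∀ {I : Set a} {J : Set b} (f : J → Comb G) (k : I → List J) is →
                  sum (map f (concatMap k is)) ≈ sum (map (λ i → sum (map f (k i))) is)
  sum-concatMap f k []       = ≈-refl
  sum-concatMap f k (i ∷ is) =
    ≈-trans (≈-reflexive (cong sum (map-++ f (k i) (concatMap k is))))
   (≈-trans (sum-++ (map f (k i)) _) (⊕-cong ≈-refl (sum-concatMap f k is)))

  Σ< : ℕ → (ℕ → Comb G) → Comb G
  Σ< zero    f = 𝟘
  Σ< (suc n) f = Σ< n f ⊕ f n

  Σ<-cong : ∀ n {f f′} → (∀ i → f i ≈ f′ i) → Σ< n f ≈ Σ< n f′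
  Σ<-cong zero    e = ≈-refl
  Σ<-cong (suc n) e = ⊕-cong (Σ<-cong n e) (e n)

  Σ<-⊕ : ∀ n f f′ → Σ< n (λ i → f i ⊕ f′ i) ≈ Σ< n f ⊕ Σ< n f′
  Σ<-⊕ zero    f f′ = ≈-sym (⊕-identityˡ 𝟘)
  Σ<-⊕ (suc n) f f′ = ≈-trans (⊕-cong (Σ<-⊕ n f f′) ≈-refl) (interchange _ _ _ _)

  Σ<-· : ∀ n q f → Σ< n (λ i → q · f i) ≈ q · Σ< n f
  Σ<-· zero    q f = ≈-sym (·-zeroʳ q)
  Σ<-· (suc n) q f = ≈-trans (⊕-cong (Σ<-· n q f) ≈-refl) (≈-sym (·-distribˡ q _ _))

  Σ<-zero : ∀ n {f} → (∀ i → i < n → f i ≈ 𝟘) → Σ< n f ≈ 𝟘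
  Σ<-zero zero    e = ≈-refl
  Σ<-zero (suc n) e = ≈-trans (⊕-cong (Σ<-zero n λ i i<n → e i (ℕₚ.m<n⇒m<1+n i<n)) (e n ℕₚ.≤-refl))
                              (⊕-identityˡ 𝟘)

  Σ<-single : ∀ n {f} k → k < n → (∀ i → k ≢ i → f i ≈ 𝟘) → Σ< n f ≈ f k
  Σ<-single (suc n) {f} k k<n e with k ℕₚ.≟ n
  ... | yes refl = ≈-trans (⊕-cong (Σ<-zero n λ i i<n → e i λ { refl → ℕₚ.<-irrefl refl i<n }) ≈-refl)
                           (⊕-identityˡ _)
  ... | no k≢n   = ≈-trans (⊕-cong (Σ<-single n k (ℕₚ.≤∧≢⇒< (ℕₚ.≤-pred k<n) k≢n) e) (e n k≢n))
                           (⊕-identityʳ _)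

module _ {G : Set g} {H : Set h} (S : Rel (Comb H) d) where
  open Presented S

  extend-cong : {R : Rel (Comb G) r} (f : G → Comb H) →
                (∀ {x y} → R x y → extend f x ≈ extend f y) →
                ∀ {x y} → Presented._≈_ R x y → extend f x ≈ extend f y
  extend-cong {R = R} f respects = go
    where
    module P = Presented R
    go : ∀ {x y} → x P.≈ y → extend f x ≈ extend f y
    go (P.relation e)        = respects e
    go P.≈-refl              = ≈-refl
    go (P.≈-sym e)           = ≈-sym (go e)
    go (P.≈-trans e e′)      = ≈-trans (go e) (go e′)
    go (P.⊕-cong e e′)       = ⊕-cong (go e) (go e′)
    go (P.·-cong q e)        = ·-cong q (go e)
    go (P.⊕-assoc x y z)     = ⊕-assoc _ _ _
    go (P.⊕-comm x y)        = ⊕-comm _ _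
    go (P.⊕-identityˡ x)     = ⊕-identityˡ _
    go (P.·-distribˡ q x y)  = ·-distribˡ _ _ _
    go (P.·-distribʳ x p q)  = ·-distribʳ _ _ _
    go (P.·-assoc p q x)     = ·-assoc _ _ _
    go (P.·-identity x)      = ·-identity _
    go (P.·-zeroˡ x)         = ·-zeroˡ _

  extend-ext : {f f′ : G → Comb H} → (∀ i → f i ≈ f′ i) → ∀ x → extend f x ≈ extend f′ x
  extend-ext e 𝟘       = ≈-refl
  extend-ext e (x ⊕ y) = ⊕-cong (extend-ext e x) (extend-ext e y)
  extend-ext e (q · x) = ·-cong q (extend-ext e x)
  extend-ext e ⟨ i ⟩   = e i

module _ {G : Set g} (R : Rel (Comb G) r) where
  open Presented R

  -- μ, e and κ are the product, the unit and the degree projections on generators.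
  record GradedProduct (Deg : ℕ → Pred G d) : Set (g ⊔ r ⊔ d) where
    field
      μ : G → G → Comb G
      e : G
      κ : ℕ → G → Comb G

    infixl 7 _⊛_
    _⊛_ : Comb G → Comb G → Comb G
    x ⊛ y = extend (λ i → extend (μ i) y) x

    field
      μ-respˡ : ∀ j {x y} → R x y → x ⊛ ⟨ j ⟩ ≈ y ⊛ ⟨ j ⟩
      μ-respʳ : ∀ i {x y} → R x y → ⟨ i ⟩ ⊛ x ≈ ⟨ i ⟩ ⊛ y
      μ-assoc : ∀ i j k → μ i j ⊛ ⟨ k ⟩ ≈ ⟨ i ⟩ ⊛ μ j k
      μ-identityˡ : ∀ i → μ e i ≈ ⟨ i ⟩
      μ-identityʳ : ∀ i → μ i e ≈ ⟨ i ⟩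
      e-deg   : Deg 0 e
      μ-deg   : ∀ {m n i j} → Deg m i → Deg n j → Span (Deg (m ℕ.+ n)) (μ i j)
      spans   : ∀ i → ∃ λ xs → All (λ y → ∃ λ n → Span (Deg n) y) xs × ⟨ i ⟩ ≈ sum xs
      κ-resp  : ∀ n {x y} → R x y → extend (κ n) x ≈ extend (κ n) y
      κ-same  : ∀ {n i} → Deg n i → κ n i ≈ ⟨ i ⟩
      κ-other : ∀ {m n i} → m ≢ n → Deg m i → κ n i ≈ 𝟘

    ⊛-distribˡ : ∀ x y z → x ⊛ (y ⊕ z) ≈ (x ⊛ y) ⊕ (x ⊛ z)
    ⊛-distribˡ 𝟘        y z = ≈-sym (⊕-identityˡ 𝟘)
    ⊛-distribˡ (x ⊕ x′) y z = ≈-trans (⊕-cong (⊛-distribˡ x y z) (⊛-distribˡ x′ y z)) (interchange _ _ _ _)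
    ⊛-distribˡ (q · x)  y z = ≈-trans (·-cong q (⊛-distribˡ x y z)) (·-distribˡ q _ _)
    ⊛-distribˡ ⟨ i ⟩    y z = ≈-refl

    ⊛-·ʳ : ∀ q x y → x ⊛ (q · y) ≈ q · (x ⊛ y)
    ⊛-·ʳ q 𝟘        y = ≈-sym (·-zeroʳ q)
    ⊛-·ʳ q (x ⊕ x′) y = ≈-trans (⊕-cong (⊛-·ʳ q x y) (⊛-·ʳ q x′ y)) (≈-sym (·-distribˡ q _ _))
    ⊛-·ʳ q (p · x)  y = ≈-trans (·-cong p (⊛-·ʳ q x y))
                       (≈-trans (≈-sym (·-assoc p q _))
                       (≈-trans (≈-reflexive (cong (_· (x ⊛ y)) (ℚₚ.*-comm p q))) (·-assoc q p _)))
    ⊛-·ʳ q ⟨ i ⟩    y = ≈-refl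

    ⊛-zeroʳ : ∀ x → x ⊛ 𝟘 ≈ 𝟘
    ⊛-zeroʳ 𝟘        = ≈-refl
    ⊛-zeroʳ (x ⊕ x′) = ≈-trans (⊕-cong (⊛-zeroʳ x) (⊛-zeroʳ x′)) (⊕-identityˡ 𝟘)
    ⊛-zeroʳ (q · x)  = ≈-trans (·-cong q (⊛-zeroʳ x)) (·-zeroʳ q)
    ⊛-zeroʳ ⟨ i ⟩    = ≈-refl

    ⊛-congʳ : ∀ x {y y′} → y ≈ y′ → x ⊛ y ≈ x ⊛ y′
    ⊛-congʳ x y≈y′ = extend-ext R (λ i → extend-cong R (μ i) (μ-respʳ i) y≈y′) x

    ⊛-congˡ : ∀ y {x x′} → x ≈ x′ → x ⊛ y ≈ x′ ⊛ y
    ⊛-congˡ y x≈x′ = extend-cong R (λ i → extend (μ i) y) (λ {x} {x′} → step x x′ y) x≈x′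
      where
      step : ∀ x x′ y → R x x′ → x ⊛ y ≈ x′ ⊛ y
      step x x′ 𝟘        ρ = ≈-trans (⊛-zeroʳ x) (≈-sym (⊛-zeroʳ x′))
      step x x′ (y ⊕ y′) ρ = ≈-trans (⊛-distribˡ x y y′)
                            (≈-trans (⊕-cong (step x x′ y ρ) (step x x′ y′ ρ)) (≈-sym (⊛-distribˡ x′ y y′)))
      step x x′ (q · y)  ρ = ≈-trans (⊛-·ʳ q x y) (≈-trans (·-cong q (step x x′ y ρ)) (≈-sym (⊛-·ʳ q x′ y)))
      step x x′ ⟨ j ⟩    ρ = μ-respˡ j ρ

    ⊛-assoc : ∀ x y z → (x ⊛ y) ⊛ z ≈ x ⊛ (y ⊛ z)
    ⊛-assoc 𝟘        y z = ≈-refl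
    ⊛-assoc (x ⊕ x′) y z = ⊕-cong (⊛-assoc x y z) (⊛-assoc x′ y z)
    ⊛-assoc (q · x)  y z = ·-cong q (⊛-assoc x y z)
    ⊛-assoc ⟨ i ⟩    y z = second y
      where
      third : ∀ j z → μ i j ⊛ z ≈ ⟨ i ⟩ ⊛ (⟨ j ⟩ ⊛ z)
      third j 𝟘        = ⊛-zeroʳ (μ i j)
      third j (z ⊕ z′) = ≈-trans (⊛-distribˡ (μ i j) z z′) (⊕-cong (third j z) (third j z′))
      third j (q · z)  = ≈-trans (⊛-·ʳ q (μ i j) z) (·-cong q (third j z))
      third j ⟨ k ⟩    = μ-assoc i j k
      second : ∀ y → (⟨ i ⟩ ⊛ y) ⊛ z ≈ ⟨ i ⟩ ⊛ (y ⊛ z)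
      second 𝟘        = ≈-refl
      second (y ⊕ y′) = ⊕-cong (second y) (second y′)
      second (q · y)  = ·-cong q (second y)
      second ⟨ j ⟩    = third j z

    ⊛-identityˡ : ∀ x → ⟨ e ⟩ ⊛ x ≈ x
    ⊛-identityˡ 𝟘       = ≈-refl
    ⊛-identityˡ (x ⊕ y) = ⊕-cong (⊛-identityˡ x) (⊛-identityˡ y)
    ⊛-identityˡ (q · x) = ·-cong q (⊛-identityˡ x)
    ⊛-identityˡ ⟨ i ⟩   = μ-identityˡ i

    ⊛-identityʳ : ∀ x → x ⊛ ⟨ e ⟩ ≈ x
    ⊛-identityʳ 𝟘       = ≈-refl
    ⊛-identityʳ (x ⊕ y) = ⊕-cong (⊛-identityʳ x) (⊛-identityʳ y)
    ⊛-identityʳ (q · x) = ·-cong q (⊛-identityʳ x)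
    ⊛-identityʳ ⟨ i ⟩   = μ-identityʳ i

    ⊛-deg : ∀ {m n x y} → Span (Deg m) x → Span (Deg n) y → Span (Deg (m ℕ.+ n)) (x ⊛ y)
    ⊛-deg (generator p)      s = go s
      where
      go : ∀ {y} → Span (Deg _) y → Span (Deg _) (⟨ _ ⟩ ⊛ y)
      go (generator p′) = μ-deg p p′
      go zero           = zero
      go (add s t)      = add (go s) (go t)
      go (scale q s)    = scale q (go s)
      go (resp ε s)     = resp (⊛-congʳ ⟨ _ ⟩ ε) (go s)
    ⊛-deg zero               s = zero
    ⊛-deg (add t t′)         s = add (⊛-deg t s) (⊛-deg t′ s)
    ⊛-deg (scale q t)        s = scale q (⊛-deg t s)
    ⊛-deg {y = y} (resp ε t) s = resp (⊛-congˡ y ε) (⊛-deg t s)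

    private
      Spanned : Pred (Comb G) _
      Spanned x = ∃ λ xs → All (λ y → ∃ λ n → Span (Deg n) y) xs × x ≈ sum xs

      scaled : ∀ q {x} → Spanned x → Spanned (q · x)
      scaled q (xs , ps , ε) = map (q ·_) xs
                             , Allₚ.map⁺ (All.map (λ { (n , s) → n , scale q s }) ps)
                             , ≈-trans (·-cong q ε) (distr xs)
        where
        distr : ∀ xs → q · sum xs ≈ sum (map (q ·_) xs)
        distr []       = ·-zeroʳ q
        distr (x ∷ xs) = ≈-trans (·-distribˡ q x _) (⊕-cong ≈-refl (distr xs))

      added : ∀ {x y} → Spanned x → Spanned y → Spanned (x ⊕ y)
      added (xs , ps , ε) (ys , qs , ε′) =
        xs ++ ys , Allₚ.++⁺ ps qs , ≈-trans (⊕-cong ε ε′) (≈-sym (sum-++ xs ys))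

      spanned : ∀ x → Spanned x
      spanned 𝟘       = [] , [] , ≈-refl
      spanned (x ⊕ y) = added (spanned x) (spanned y)
      spanned (q · x) = scaled q (spanned x)
      spanned ⟨ i ⟩   = spans i

      comp : ℕ → Comb G → Comb G
      comp n = extend (κ n)

      comp-cong : ∀ n {x y} → x ≈ y → comp n x ≈ comp n y
      comp-cong n = extend-cong R (κ n) (κ-resp n)

      comp-same : ∀ {n x} → Span (Deg n) x → comp n x ≈ x
      comp-same (generator p) = κ-same p
      comp-same zero          = ≈-refl
      comp-same (add s t)     = ⊕-cong (comp-same s) (comp-same t)
      comp-same (scale q s)   = ·-cong q (comp-same s)
      comp-same (resp ε s)    = ≈-trans (comp-cong _ (≈-sym ε)) (≈-trans (comp-same s) ε)

      comp-other : ∀ {m n x} → m ≢ n → Span (Deg m) x → comp n x ≈ 𝟘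
      comp-other ne (generator p) = κ-other ne p
      comp-other ne zero          = ≈-refl
      comp-other ne (add s t)     = ≈-trans (⊕-cong (comp-other ne s) (comp-other ne t)) (⊕-identityˡ 𝟘)
      comp-other ne (scale q s)   = ≈-trans (·-cong q (comp-other ne s)) (·-zeroʳ q)
      comp-other ne (resp ε s)    = ≈-trans (comp-cong _ (≈-sym ε)) (comp-other ne s)

    gradedAlgebra : GradedAlgebra g (g ⊔ r) (g ⊔ r ⊔ d)
    gradedAlgebra = record
      { Carrier = Comb G
      ; _≈_ = _≈_ ; _+_ = _⊕_ ; _*_ = _⊛_ ; -_ = ⊖_ ; 0# = 𝟘 ; 1# = ⟨ e ⟩ ; _·_ = _·_
      ; isRing = record
        { +-isAbelianGroup = IsLeftModule.+ᴹ-isAbelianGroup isLeftModule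
        ; *-cong = λ {x} {x′} {y} {y′} ε ε′ → ≈-trans (⊛-congˡ y ε) (⊛-congʳ x′ ε′)
        ; *-assoc = ⊛-assoc
        ; *-identity = ⊛-identityˡ , ⊛-identityʳ
        ; distrib = ⊛-distribˡ , λ _ _ _ → ≈-refl }
      ; isLeftModule = isLeftModule
      ; *-·-assocˡ = λ _ _ _ → ≈-refl
      ; *-·-assocʳ = ⊛-·ʳ
      ; Homogeneous = λ n → Span (Deg n)
      ; homogeneous-resp-≈ = resp
      ; homogeneous-0 = zero
      ; homogeneous-+ = add
      ; homogeneous-· = scale
      ; homogeneous-1 = generator e-deg
      ; homogeneous-* = ⊛-deg
      ; homogeneous-spans = spanned
      ; component = comp
      ; component-cong = comp-cong
      ; component-+ = λ _ _ _ → ≈-refl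
      ; component-· = λ _ _ _ → ≈-refl
      ; component-same = comp-same
      ; component-other = comp-other
      }

module Tensor (A : GradedAlgebra c₁ ℓ₁ h₁) (B : GradedAlgebra c₂ ℓ₂ h₂) where
  private
    module A = GradedAlgebra A
    module B = GradedAlgebra B

  -- A generator ⟨ x , y ⟩ stands for the pure tensor x ⊗ y.
  data Bilinear : Rel (Comb (A.Carrier × B.Carrier)) (c₁ ⊔ ℓ₁ ⊔ c₂ ⊔ ℓ₂) where
    ⊗-cong     : ∀ {x x′ y y′} → x A.≈ x′ → y B.≈ y′ → Bilinear ⟨ x , y ⟩ ⟨ x′ , y′ ⟩
    ⊗-distribʳ : ∀ x x′ y → Bilinear ⟨ x A.+ x′ , y ⟩ (⟨ x , y ⟩ ⊕ ⟨ x′ , y ⟩)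
    ⊗-distribˡ : ∀ x y y′ → Bilinear ⟨ x , y B.+ y′ ⟩ (⟨ x , y ⟩ ⊕ ⟨ x , y′ ⟩)
    ⊗-·ˡ       : ∀ q x y → Bilinear ⟨ q A.· x , y ⟩ (q · ⟨ x , y ⟩)
    ⊗-·ʳ       : ∀ q x y → Bilinear ⟨ x , q B.· y ⟩ (q · ⟨ x , y ⟩)

  TensorDegree : ℕ → Pred (A.Carrier × B.Carrier) (h₁ ⊔ h₂)
  TensorDegree n (x , y) = ∃₂ λ i j → i ℕ.+ j ≡ n × A.Homogeneous i x × B.Homogeneous j y

  open Presented Bilinear
  private
    module AM = LeftModule A.leftModule
    module BM = LeftModule B.leftModule

  ⊗-zeroˡ : ∀ y → ⟨ A.0# , y ⟩ ≈ 𝟘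
  ⊗-zeroˡ y = ≈-trans (relation (⊗-cong (A.sym (AM.*ₗ-zeroˡ A.0#)) B.refl))
             (≈-trans (relation (⊗-·ˡ 0ℚ A.0# y)) (·-zeroˡ _))

  ⊗-zeroʳ : ∀ x → ⟨ x , B.0# ⟩ ≈ 𝟘
  ⊗-zeroʳ x = ≈-trans (relation (⊗-cong A.refl (B.sym (BM.*ₗ-zeroˡ B.0#))))
             (≈-trans (relation (⊗-·ʳ 0ℚ x B.0#)) (·-zeroˡ _))

  ⊗-congˡ : ∀ {x x′ y} → x A.≈ x′ → ⟨ x , y ⟩ ≈ ⟨ x′ , y ⟩
  ⊗-congˡ ε = relation (⊗-cong ε B.refl)

  ⊗-congʳ : ∀ {x y y′} → y B.≈ y′ → ⟨ x , y ⟩ ≈ ⟨ x , y′ ⟩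
  ⊗-congʳ ε = relation (⊗-cong A.refl ε)

  μ⊗ : A.Carrier × B.Carrier → A.Carrier × B.Carrier → Comb (A.Carrier × B.Carrier)
  μ⊗ (x , y) (x′ , y′) = ⟨ x A.* x′ , y B.* y′ ⟩

  term : ℕ → A.Carrier → B.Carrier → ℕ → Comb (A.Carrier × B.Carrier)
  term n x y i = ⟨ A.component i x , B.component (n ∸ i) y ⟩

  κ⊗ : ℕ → A.Carrier × B.Carrier → Comb (A.Carrier × B.Carrier)
  κ⊗ n (x , y) = Σ< (suc n) (term n x y)

  mul : Comb (A.Carrier × B.Carrier) → Comb (A.Carrier × B.Carrier) → Comb (A.Carrier × B.Carrier)
  mul s t = extend (λ i → extend (μ⊗ i) t) s

  respˡ : ∀ j {s t} → Bilinear s t → mul s ⟨ j ⟩ ≈ mul t ⟨ j ⟩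
  respˡ j (⊗-cong ε ε′)       = relation (⊗-cong (A.*-cong ε A.refl) (B.*-cong ε′ B.refl))
  respˡ j (⊗-distribʳ x x′ y) = ≈-trans (⊗-congˡ (A.distribʳ _ x x′)) (relation (⊗-distribʳ _ _ _))
  respˡ j (⊗-distribˡ x y y′) = ≈-trans (⊗-congʳ (B.distribʳ _ y y′)) (relation (⊗-distribˡ _ _ _))
  respˡ j (⊗-·ˡ q x y)        = ≈-trans (⊗-congˡ (A.*-·-assocˡ q x _)) (relation (⊗-·ˡ _ _ _))
  respˡ j (⊗-·ʳ q x y)        = ≈-trans (⊗-congʳ (B.*-·-assocˡ q y _)) (relation (⊗-·ʳ _ _ _))

  respʳ : ∀ i {s t} → Bilinear s t → mul ⟨ i ⟩ s ≈ mul ⟨ i ⟩ t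
  respʳ i (⊗-cong ε ε′)       = relation (⊗-cong (A.*-cong A.refl ε) (B.*-cong B.refl ε′))
  respʳ i (⊗-distribʳ x x′ y) = ≈-trans (⊗-congˡ (A.distribˡ _ x x′)) (relation (⊗-distribʳ _ _ _))
  respʳ i (⊗-distribˡ x y y′) = ≈-trans (⊗-congʳ (B.distribˡ _ y y′)) (relation (⊗-distribˡ _ _ _))
  respʳ i (⊗-·ˡ q x y)        = ≈-trans (⊗-congˡ (A.*-·-assocʳ q _ x)) (relation (⊗-·ˡ _ _ _))
  respʳ i (⊗-·ʳ q x y)        = ≈-trans (⊗-congʳ (B.*-·-assocʳ q _ y)) (relation (⊗-·ʳ _ _ _))

  κ⊗-resp : ∀ n {s t} → Bilinear s t → extend (κ⊗ n) s ≈ extend (κ⊗ n) t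
  κ⊗-resp n (⊗-cong ε ε′) =
    Σ<-cong (suc n) λ i → relation (⊗-cong (A.component-cong i ε) (B.component-cong (n ∸ i) ε′))
  κ⊗-resp n (⊗-distribʳ x x′ y) =
    ≈-trans (Σ<-cong (suc n) λ i → ≈-trans (⊗-congˡ (A.component-+ i x x′)) (relation (⊗-distribʳ _ _ _)))
            (Σ<-⊕ (suc n) (term n x y) (term n x′ y))
  κ⊗-resp n (⊗-distribˡ x y y′) =
    ≈-trans (Σ<-cong (suc n) λ i → ≈-trans (⊗-congʳ (B.component-+ (n ∸ i) y y′)) (relation (⊗-distribˡ _ _ _)))
            (Σ<-⊕ (suc n) (term n x y) (term n x y′))
  κ⊗-resp n (⊗-·ˡ q x y) =
    ≈-trans (Σ<-cong (suc n) λ i → ≈-trans (⊗-congˡ (A.component-· i q x)) (relation (⊗-·ˡ _ _ _)))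
            (Σ<-· (suc n) q (term n x y))
  κ⊗-resp n (⊗-·ʳ q x y) =
    ≈-trans (Σ<-cong (suc n) λ i → ≈-trans (⊗-congʳ (B.component-· (n ∸ i) q y)) (relation (⊗-·ʳ _ _ _)))
            (Σ<-· (suc n) q (term n x y))

  κ⊗-same : ∀ {n i} → TensorDegree n i → κ⊗ n i ≈ ⟨ i ⟩
  κ⊗-same {i = x , y} (k , l , refl , p , q) =
    ≈-trans (Σ<-single (suc (k ℕ.+ l)) k (s≤s (ℕₚ.m≤m+n k l))
              (λ i k≢i → ≈-trans (⊗-congˡ (A.component-other k≢i p)) (⊗-zeroˡ _)))
            (relation (⊗-cong (A.component-same p)
              (subst (λ j → B.component j y B.≈ y) (sym (ℕₚ.m+n∸m≡n k l)) (B.component-same q))))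

  κ⊗-other : ∀ {m n i} → m ≢ n → TensorDegree m i → κ⊗ n i ≈ 𝟘
  κ⊗-other {n = n} {x , y} m≢n (k , l , refl , p , q) = Σ<-zero (suc n) vanish
    where
    vanish : ∀ i → i < suc n → term n x y i ≈ 𝟘
    vanish i (s≤s i≤n) with k ℕₚ.≟ i
    ... | no k≢i   = ≈-trans (⊗-congˡ (A.component-other k≢i p)) (⊗-zeroˡ _)
    ... | yes refl = ≈-trans (⊗-congʳ (B.component-other l≢n∸k q)) (⊗-zeroʳ _)
      where
      l≢n∸k : l ≢ n ∸ k
      l≢n∸k refl = m≢n (ℕₚ.m+[n∸m]≡n i≤n)

  Spanned : Pred (Comb (A.Carrier × B.Carrier)) _
  Spanned s = ∃ λ xs → All (λ t → ∃ λ n → Span (TensorDegree n) t) xs × s ≈ sum xs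

  spanned-⊕ : ∀ {s t} → Spanned s → Spanned t → Spanned (s ⊕ t)
  spanned-⊕ (xs , ps , ε) (ys , qs , ε′) =
    xs ++ ys , Allₚ.++⁺ ps qs , ≈-trans (⊕-cong ε ε′) (≈-sym (sum-++ xs ys))

  spanned-resp : ∀ {s t} → s ≈ t → Spanned t → Spanned s
  spanned-resp ε (xs , ps , ε′) = xs , ps , ≈-trans ε ε′

  spans⊗ : ∀ i → Spanned ⟨ i ⟩
  spans⊗ (x , y) with A.homogeneous-spans x | B.homogeneous-spans y
  ... | xs , ps , ε | ys , qs , ε′ = spanned-resp (relation (⊗-cong ε ε′)) (left xs ps)
    where
    right : ∀ x ys → (∃ λ n → A.Homogeneous n x) → All (λ y → ∃ λ n → B.Homogeneous n y) ys →
            Spanned ⟨ x , foldr B._+_ B.0# ys ⟩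
    right x []       _       _               = [] , [] , ⊗-zeroʳ x
    right x (y ∷ ys) (m , p) ((n , q) ∷ qs) =
      spanned-resp (relation (⊗-distribˡ x y _))
        (spanned-⊕ (⟨ x , y ⟩ ∷ [] , (m ℕ.+ n , generator (m , n , refl , p , q)) ∷ [] , ≈-sym (⊕-identityʳ _))
                   (right x ys (m , p) qs))
    left : ∀ xs → All (λ x → ∃ λ n → A.Homogeneous n x) xs →
           Spanned ⟨ foldr A._+_ A.0# xs , foldr B._+_ B.0# ys ⟩
    left []       _        = [] , [] , ⊗-zeroˡ _
    left (x ∷ xs) (p ∷ ps) = spanned-resp (relation (⊗-distribʳ x _ _)) (spanned-⊕ (right x ys p qs) (left xs ps))

  tensorProduct : GradedProduct Bilinear TensorDegree
  tensorProduct = record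
    { μ = μ⊗
    ; e = A.1# , B.1#
    ; κ = κ⊗
    ; μ-respˡ = respˡ
    ; μ-respʳ = respʳ
    ; μ-assoc = λ { (x , y) (x′ , y′) (x″ , y″) → relation (⊗-cong (A.*-assoc x x′ x″) (B.*-assoc y y′ y″)) }
    ; μ-identityˡ = λ { (x , y) → relation (⊗-cong (A.*-identityˡ x) (B.*-identityˡ y)) }
    ; μ-identityʳ = λ { (x , y) → relation (⊗-cong (A.*-identityʳ x) (B.*-identityʳ y)) }
    ; e-deg = 0 , 0 , refl , A.homogeneous-1 , B.homogeneous-1
    ; μ-deg = λ { (i , j , refl , p , q) (i′ , j′ , refl , p′ , q′) →
                  generator (i ℕ.+ i′ , j ℕ.+ j′ , exchange i i′ j j′ , A.homogeneous-* p p′ , B.homogeneous-* q q′) }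
    ; spans = spans⊗
    ; κ-resp = κ⊗-resp
    ; κ-same = κ⊗-same
    ; κ-other = κ⊗-other
    }
    where
    exchange : ∀ i i′ j j′ → (i ℕ.+ i′) ℕ.+ (j ℕ.+ j′) ≡ (i ℕ.+ j) ℕ.+ (i′ ℕ.+ j′)
    exchange i i′ j j′ = trans (ℕₚ.+-assoc i i′ _)
      (trans (cong (i ℕ.+_) (trans (sym (ℕₚ.+-assoc i′ j j′))
                            (trans (cong (ℕ._+ j′) (ℕₚ.+-comm i′ j)) (ℕₚ.+-assoc j i′ j′))))
             (sym (ℕₚ.+-assoc i j _)))

-- (x ⊗ y) * (x′ ⊗ y′) = (x * x′) ⊗ (y * y′), without signs.
infixr 7 _⊗_
_⊗_ : GradedAlgebra c₁ ℓ₁ h₁ → GradedAlgebra c₂ ℓ₂ h₂ →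
      GradedAlgebra (c₁ ⊔ c₂) (c₁ ⊔ ℓ₁ ⊔ c₂ ⊔ ℓ₂) (c₁ ⊔ ℓ₁ ⊔ h₁ ⊔ c₂ ⊔ ℓ₂ ⊔ h₂)
A ⊗ B = GradedProduct.gradedAlgebra (Tensor.tensorProduct A B)

record Permutation : Set where
  constructor permutation
  field
    letters  : List ℕ
    distinct : Unique letters
    positive : All (0 <_) letters

open Permutation public

∣_∣ : Permutation → ℕ
∣ π ∣ = length (letters π)

SameRelativeOrder : Rel Permutation 0ℓ
SameRelativeOrder π σ = Σ (∣ π ∣ ≡ ∣ σ ∣) λ eq → ∀ (i j : Fin ∣ π ∣) →
  (lookup (letters π) i < lookup (letters π) j) ⇔
  (lookup (letters σ) (cast eq i) < lookup (letters σ) (cast eq j))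

record Statistic (V : Set v) : Set v where
  field
    st        : Permutation → V
    invariant : ∀ {π σ} → SameRelativeOrder π σ → st π ≡ st σ

infix 4 _≪_
_≪_ : Rel Permutation 0ℓ
π ≪ σ = All (λ p → All (p <_) (letters σ)) (letters π)

≪⇒disjoint : ∀ π σ → π ≪ σ → Disjoint (letters π) (letters σ)
≪⇒disjoint π σ π≪σ (x∈π , x∈σ) = ℕₚ.<-irrefl refl (All.lookup (All.lookup π≪σ x∈π) x∈σ)

empty : Permutation
empty = permutation [] [] []

prefix suffix : ℕ → Permutation → Permutation
prefix i (permutation xs u p) = permutation (take i xs) (Uniqueₚ.take⁺ i u) (Allₚ.take⁺ i p)
suffix i (permutation xs u p) = permutation (drop i xs) (Uniqueₚ.drop⁺ i u) (Allₚ.drop⁺ i p)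

-- π_i ⋯ π_j, with letters numbered from 1.
substring : ℕ → ℕ → Permutation → Permutation
substring i j π = suffix (i ∸ 1) (prefix j π)

shift : ℕ → Permutation → Permutation
shift n (permutation xs u p) = permutation (map (n ℕ.+_) xs)
  (Uniqueₚ.map⁺ (ℕₚ.+-cancelˡ-≡ n _ _) u)
  (Allₚ.map⁺ (All.map (λ {x} 0<x → ℕₚ.≤-trans 0<x (ℕₚ.m≤n+m x n)) p))

infixr 6 _⧢_
_⧢_ : List ℕ → List ℕ → List (List ℕ)
[]       ⧢ ys       = [ ys ]
(x ∷ xs) ⧢ []       = [ x ∷ xs ]
(x ∷ xs) ⧢ (y ∷ ys) = map (x ∷_) (xs ⧢ (y ∷ ys)) ++ map (y ∷_) ((x ∷ xs) ⧢ ys)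

interleaving-[]ˡ : ∀ (ys : List ℕ) → Interleaving [] ys ys
interleaving-[]ˡ []       = []
interleaving-[]ˡ (y ∷ ys) = consʳ (interleaving-[]ˡ ys)

interleaving-[]ʳ : ∀ (xs : List ℕ) → Interleaving xs [] xs
interleaving-[]ʳ []       = []
interleaving-[]ʳ (x ∷ xs) = consˡ (interleaving-[]ʳ xs)

⧢-interleaving : ∀ xs ys → All (Interleaving xs ys) (xs ⧢ ys)
⧢-interleaving []       ys       = interleaving-[]ˡ ys ∷ []
⧢-interleaving (x ∷ xs) []       = interleaving-[]ʳ (x ∷ xs) ∷ []
⧢-interleaving (x ∷ xs) (y ∷ ys) = Allₚ.++⁺
  (Allₚ.map⁺ (All.map (λ i → consˡ i) (⧢-interleaving xs (y ∷ ys))))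
  (Allₚ.map⁺ (All.map (λ i → consʳ i) (⧢-interleaving (x ∷ xs) ys)))

unique-resp-↭ : ∀ {xs ys : List ℕ} → xs ↭ ys → Unique xs → Unique ys
unique-resp-↭ _↭_.refl         u                       = u
unique-resp-↭ (_↭_.prep x p)   (x∉ ∷ u)                = All-resp-↭ p x∉ ∷ unique-resp-↭ p u
unique-resp-↭ (_↭_.swap x y p) ((x≢y ∷ x∉) ∷ (y∉ ∷ u)) =
  ((x≢y ∘ sym) ∷ All-resp-↭ p y∉) ∷ (All-resp-↭ p x∉ ∷ unique-resp-↭ p u)
unique-resp-↭ (_↭_.trans p q)  u                       = unique-resp-↭ q (unique-resp-↭ p u)

fromInterleaving : ∀ π σ → Disjoint (letters π) (letters σ) →
                   ∀ {τ} → Interleaving (letters π) (letters σ) τ → Permutation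
fromInterleaving π σ disj {τ} i = permutation τ
  (unique-resp-↭ (↭-sym (toPermutation i)) (Uniqueₚ.++⁺ (distinct π) (distinct σ) disj))
  (All-resp-↭ (↭-sym (toPermutation i)) (Allₚ.++⁺ (positive π) (positive σ)))

shuffle : ∀ π σ → Disjoint (letters π) (letters σ) → List Permutation
shuffle π σ disj = All.reduce (fromInterleaving π σ disj) (⧢-interleaving (letters π) (letters σ))

letters-shuffle : ∀ π σ (disj : Disjoint (letters π) (letters σ)) → map letters (shuffle π σ disj) ≡ letters π ⧢ letters σ
letters-shuffle π σ disj = go (⧢-interleaving (letters π) (letters σ))
  where
  go : ∀ {τs} (is : All (Interleaving (letters π) (letters σ)) τs) →
       map letters (All.reduce (fromInterleaving π σ disj) is) ≡ τs
  go []       = refl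
  go (i ∷ is) = cong (_ ∷_) (go is)

-- The next two facts say that _⧢_ enumerates, without repetition, the
-- sequences of length |xs| + |ys| having xs and ys as subsequences.

∈-⧢⇔ : ∀ {xs ys} → Disjoint xs ys → ∀ {τ} →
       τ ∈ xs ⧢ ys ⇔ (length τ ≡ length xs ℕ.+ length ys × xs ⊆ τ × ys ⊆ τ)
∈-⧢⇔ {xs} {ys} disj = mk⇔
  (λ τ∈ → let i = All.lookup (⧢-interleaving xs ys) τ∈ in
          trans (↭-length (toPermutation i)) (length-++ xs) , sublistˡ i , sublistʳ i)
  (λ { (eq , p , q) → enumerated (interleave disj (ℕₚ.≤-reflexive eq) p q) })
  where
  sublistˡ : ∀ {xs ys τ} → Interleaving xs ys τ → xs ⊆ τ
  sublistˡ []        = []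
  sublistˡ (consˡ i) = refl ∷ sublistˡ i
  sublistˡ (consʳ i) = _ ∷ʳ sublistˡ i

  sublistʳ : ∀ {xs ys τ} → Interleaving xs ys τ → ys ⊆ τ
  sublistʳ []        = []
  sublistʳ (consˡ i) = _ ∷ʳ sublistʳ i
  sublistʳ (consʳ i) = refl ∷ sublistʳ i

  bound : ∀ {xs ys τ : List ℕ} → Disjoint xs ys → xs ⊆ τ → ys ⊆ τ → length xs ℕ.+ length ys ≤ length τ
  bound disj []         []         = z≤n
  bound disj (_ ∷ʳ p)   (_ ∷ʳ q)   = ℕₚ.m≤n⇒m≤1+n (bound disj p q)
  bound disj (refl ∷ p) (_ ∷ʳ q)   = s≤s (bound (λ (i , j) → disj (there i , j)) p q)
  bound {xs} {τ = _ ∷ τ} disj (_ ∷ʳ p) (refl ∷ q) =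
    subst (_≤ suc (length τ)) (sym (ℕₚ.+-suc (length xs) _)) (s≤s (bound (λ (i , j) → disj (i , there j)) p q))
  bound disj (refl ∷ p) (refl ∷ q) = ⊥-elim (disj (here refl , here refl))

  interleave : ∀ {xs ys τ : List ℕ} → Disjoint xs ys → length τ ≤ length xs ℕ.+ length ys →
               xs ⊆ τ → ys ⊆ τ → Interleaving xs ys τ
  interleave disj le []         []         = []
  interleave disj le (_ ∷ʳ p)   (_ ∷ʳ q)   = ⊥-elim (ℕₚ.<-irrefl refl (ℕₚ.≤-trans le (bound disj p q)))
  interleave disj (s≤s le) (refl ∷ p) (_ ∷ʳ q) = consˡ (interleave (λ (i , j) → disj (there i , j)) le p q)
  interleave {xs} {τ = _ ∷ τ} disj le (_ ∷ʳ p) (refl ∷ q) =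
    consʳ (interleave (λ (i , j) → disj (i , there j)) (ℕₚ.≤-pred (subst (suc (length τ) ≤_) (ℕₚ.+-suc (length xs) _) le)) p q)
  interleave disj le (refl ∷ p) (refl ∷ q) = ⊥-elim (disj (here refl , here refl))

  right-only : ∀ {ys τ : List ℕ} → Interleaving [] ys τ → τ ≡ ys
  right-only []        = refl
  right-only (consʳ i) = cong (_ ∷_) (right-only i)

  left-only : ∀ {xs τ : List ℕ} → Interleaving xs [] τ → τ ≡ xs
  left-only []        = refl
  left-only (consˡ i) = cong (_ ∷_) (left-only i)

  enumerated : ∀ {xs ys τ} → Interleaving xs ys τ → τ ∈ xs ⧢ ys
  enumerated {[]}             i         = here (right-only i)
  enumerated {x ∷ xs} {[]}    i         = here (left-only i)
  enumerated {x ∷ xs} {_ ∷ _} (consˡ i) = ∈-++⁺ˡ (∈-map⁺ (x ∷_) (enumerated i))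
  enumerated {x ∷ xs} {y ∷ _} (consʳ i) = ∈-++⁺ʳ (map (x ∷_) (xs ⧢ _)) (∈-map⁺ (y ∷_) (enumerated i))

⧢-unique : ∀ xs ys → Disjoint xs ys → Unique (xs ⧢ ys)
⧢-unique []       ys       disj = [] ∷ []
⧢-unique (x ∷ xs) []       disj = [] ∷ []
⧢-unique (x ∷ xs) (y ∷ ys) disj = Uniqueₚ.++⁺
  (Uniqueₚ.map⁺ (λ { refl → refl }) (⧢-unique xs (y ∷ ys) (λ (i , j) → disj (there i , j))))
  (Uniqueₚ.map⁺ (λ { refl → refl }) (⧢-unique (x ∷ xs) ys (λ (i , j) → disj (i , there j))))
  heads
  where
  heads : Disjoint (map (x ∷_) (xs ⧢ (y ∷ ys))) (map (y ∷_) ((x ∷ xs) ⧢ ys))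
  heads (p , q) with ∈-map⁻ (x ∷_) p | ∈-map⁻ (y ∷_) q
  ... | _ , _ , refl | _ , _ , refl = disj (here refl , here refl)

⧢-[]ʳ : ∀ xs → xs ⧢ [] ≡ [ xs ]
⧢-[]ʳ []      = refl
⧢-[]ʳ (_ ∷ _) = refl

concatMap-[-] : ∀ {A : Set a} (f : A → List A) → (∀ x → f x ≡ [ x ]) → ∀ xs → concatMap f xs ≡ xs
concatMap-[-] f eq []       = refl
concatMap-[-] f eq (x ∷ xs) rewrite eq x = cong (x ∷_) (concatMap-[-] f eq xs)

concatMap-⊎ : ∀ {A : Set a} {B : Set b} (f k : A → List B) xs →
              concatMap (λ x → f x ++ k x) xs ↭ concatMap f xs ++ concatMap k xs
concatMap-⊎ f k []       = ↭-refl
concatMap-⊎ f k (x ∷ xs) =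
  ↭-trans (↭-reflexive (++-assoc (f x) (k x) _))
 (↭-trans (++⁺ˡ (f x)
            (↭-trans (++⁺ˡ (k x) (concatMap-⊎ f k xs))
            (↭-trans (↭-reflexive (sym (++-assoc (k x) (concatMap f xs) _)))
            (↭-trans (++⁺ (++-comm (k x) (concatMap f xs)) ↭-refl)
                     (↭-reflexive (++-assoc (concatMap f xs) (k x) _))))))
          (↭-reflexive (sym (++-assoc (f x) (concatMap f xs) _))))

private
  concatMap-cons : ∀ x (f : List ℕ → List (List ℕ)) τs →
                   concatMap (λ τ → map (x ∷_) (f τ)) τs ≡ map (x ∷_) (concatMap f τs)
  concatMap-cons x f τs = sym (map-concatMap (x ∷_) f τs)

⧢-assoc : ∀ xs ys zs → concatMap (_⧢ zs) (xs ⧢ ys) ↭ concatMap (xs ⧢_) (ys ⧢ zs)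
⧢-assoc []       ys       zs       = ↭-reflexive (trans (++-identityʳ _) (sym (concatMap-[-] _ (λ _ → refl) (ys ⧢ zs))))
⧢-assoc (x ∷ xs) []       zs       = ↭-refl
⧢-assoc (x ∷ xs) (y ∷ ys) []       =
  ↭-reflexive (trans (concatMap-[-] (_⧢ []) ⧢-[]ʳ ((x ∷ xs) ⧢ (y ∷ ys))) (sym (++-identityʳ _)))
⧢-assoc (x ∷ xs) (y ∷ ys) (z ∷ zs) =
  ↭-trans lhs
 (↭-trans (++⁺ (++⁺ (map⁺ (x ∷_) (⧢-assoc xs (y ∷ ys) (z ∷ zs))) (map⁺ (y ∷_) (⧢-assoc (x ∷ xs) ys (z ∷ zs))))
               (map⁺ (z ∷_) (⧢-assoc (x ∷ xs) (y ∷ ys) zs)))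
          (↭-sym rhs))
  where
  X = x ∷ xs
  Y = y ∷ ys
  Z = z ∷ zs

  L : List ℕ → List ℕ → List ℕ → List (List ℕ)
  L as bs cs = concatMap (_⧢ cs) (as ⧢ bs)

  R : List ℕ → List ℕ → List ℕ → List (List ℕ)
  R as bs cs = concatMap (as ⧢_) (bs ⧢ cs)

  expandˡ : ∀ w τs → concatMap (_⧢ Z) (map (w ∷_) τs) ↭
            map (w ∷_) (concatMap (_⧢ Z) τs) ++ map (z ∷_) (concatMap (_⧢ zs) (map (w ∷_) τs))
  expandˡ w τs =
    ↭-trans (↭-reflexive (concatMap-map (_⧢ Z) (w ∷_) τs))
   (↭-trans (concatMap-⊎ (λ τ → map (w ∷_) (τ ⧢ Z)) (λ τ → map (z ∷_) ((w ∷ τ) ⧢ zs)) τs)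
            (↭-reflexive (cong₂ _++_ (concatMap-cons w (_⧢ Z) τs)
               (trans (concatMap-cons z (λ τ → (w ∷ τ) ⧢ zs) τs)
                      (cong (map (z ∷_)) (sym (concatMap-map (_⧢ zs) (w ∷_) τs)))))))

  expandʳ : ∀ w τs → concatMap (X ⧢_) (map (w ∷_) τs) ↭
            map (x ∷_) (concatMap (xs ⧢_) (map (w ∷_) τs)) ++ map (w ∷_) (concatMap (X ⧢_) τs)
  expandʳ w τs =
    ↭-trans (↭-reflexive (concatMap-map (X ⧢_) (w ∷_) τs))
   (↭-trans (concatMap-⊎ (λ τ → map (x ∷_) (xs ⧢ (w ∷ τ))) (λ τ → map (w ∷_) (X ⧢ τ)) τs)
            (↭-reflexive (cong₂ _++_
               (trans (concatMap-cons x (λ τ → xs ⧢ (w ∷ τ)) τs)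
                      (cong (map (x ∷_)) (sym (concatMap-map (xs ⧢_) (w ∷_) τs))))
               (concatMap-cons w (X ⧢_) τs))))

  exchange : ∀ (p q s t : List (List ℕ)) → (p ++ q) ++ (s ++ t) ↭ (p ++ s) ++ (q ++ t)
  exchange p q s t =
    ↭-trans (↭-reflexive (++-assoc p q (s ++ t)))
   (↭-trans (++⁺ˡ p (↭-trans (↭-reflexive (sym (++-assoc q s t)))
                    (↭-trans (++⁺ (++-comm q s) ↭-refl) (↭-reflexive (++-assoc s q t)))))
            (↭-reflexive (sym (++-assoc p s (q ++ t)))))

  merge : ∀ w (f : List ℕ → List (List ℕ)) τs υs →
          map (w ∷_) (concatMap f τs) ++ map (w ∷_) (concatMap f υs) ≡ map (w ∷_) (concatMap f (τs ++ υs))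
  merge w f τs υs = trans (sym (map-++ (w ∷_) (concatMap f τs) _)) (cong (map (w ∷_)) (sym (concatMap-++ f τs υs)))

  lhs : L X Y Z ↭ (map (x ∷_) (L xs Y Z) ++ map (y ∷_) (L X ys Z)) ++ map (z ∷_) (L X Y zs)
  lhs = ↭-trans (↭-reflexive (concatMap-++ (_⧢ Z) (map (x ∷_) (xs ⧢ Y)) _))
       (↭-trans (++⁺ (expandˡ x (xs ⧢ Y)) (expandˡ y (X ⧢ ys)))
       (↭-trans (exchange (map (x ∷_) (L xs Y Z)) _ (map (y ∷_) (L X ys Z)) _)
                (++⁺ˡ (map (x ∷_) (L xs Y Z) ++ map (y ∷_) (L X ys Z))
                      (↭-reflexive (merge z (_⧢ zs) (map (x ∷_) (xs ⧢ Y)) _)))))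

  rhs : R X Y Z ↭ (map (x ∷_) (R xs Y Z) ++ map (y ∷_) (R X ys Z)) ++ map (z ∷_) (R X Y zs)
  rhs = ↭-trans (↭-reflexive (concatMap-++ (X ⧢_) (map (y ∷_) (ys ⧢ Z)) _))
       (↭-trans (++⁺ (expandʳ y (ys ⧢ Z)) (expandʳ z (Y ⧢ zs)))
       (↭-trans (exchange (map (x ∷_) (concatMap (xs ⧢_) (map (y ∷_) (ys ⧢ Z)))) _ _ _)
       (↭-trans (++⁺ (↭-reflexive (merge x (xs ⧢_) (map (y ∷_) (ys ⧢ Z)) _)) ↭-refl)
                (↭-reflexive (sym (++-assoc (map (x ∷_) (R xs Y Z)) _ _))))))

module _ {V : Set v} (S : Statistic V) where
  open Statistic S

  infix 4 _∼_
  _∼_ : Rel Permutation v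
  π ∼ σ = ∣ π ∣ ≡ ∣ σ ∣ × st π ≡ st σ

  WeaklyShuffleCompatible : Set v
  WeaklyShuffleCompatible =
    ∀ {π π′ σ σ′} (π≪σ : π ≪ σ) (π′≪σ′ : π′ ≪ σ′) →
    ∣ π ∣ ≡ ∣ π′ ∣ → ∣ σ ∣ ≡ ∣ σ′ ∣ → st π ≡ st π′ → st σ ≡ st σ′ →
    map st (shuffle π σ (≪⇒disjoint π σ π≪σ)) ↭ map st (shuffle π′ σ′ (≪⇒disjoint π′ σ′ π′≪σ′))

  SubstringCompatible : Set v
  SubstringCompatible =
    ∀ {π σ} → π ∼ σ → ∀ i j → 1 ≤ i → i ≤ j → j ≤ ∣ π ∣ → substring i j π ∼ substring i j σ

  WeaklyBicompatible : Set v
  WeaklyBicompatible = WeaklyShuffleCompatible × SubstringCompatible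

≪-shift-max : ∀ π σ → π ≪ shift (max 0 (letters π)) σ
≪-shift-max π σ = All.map
  (λ p≤m → Allₚ.map⁺ (All.map (λ {s} 0<s → ℕₚ.≤-<-trans p≤m (ℕₚ.m<m+n _ 0<s)) (positive σ)))
  (xs≤max 0 (letters π))

module ShuffleAlgebra {V : Set v} (S : Statistic V) where
  open Statistic S

  -- The vector space with basis the ∼-classes: ⟨ π ⟩ stands for [π].
  data Class : Rel (Comb Permutation) v where
    class : ∀ {π σ} → _∼_ S π σ → Class ⟨ π ⟩ ⟨ σ ⟩

  -- [π][σ], computed from the representatives π ≪ shift (max π) σ.
  product : Permutation → Permutation → Comb Permutation
  product π σ = sum (map ⟨_⟩ (shuffle π σ′ (≪⇒disjoint π σ′ (≪-shift-max π σ))))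
    where σ′ = shift (max 0 (letters π)) σ

  Length : ℕ → Pred Permutation 0ℓ
  Length n π = ∣ π ∣ ≡ n

  projection : ℕ → Permutation → Comb Permutation
  projection n π with ∣ π ∣ ℕₚ.≟ n
  ... | yes _ = ⟨ π ⟩
  ... | no  _ = 𝟘

  open Presented Class

  private
    _∼′_ : Rel Permutation v
    _∼′_ = _∼_ S

    ∼-refl : ∀ π → π ∼′ π
    ∼-refl π = refl , refl

  letters-∼ : ∀ {π σ} → letters π ≡ letters σ → π ∼′ σ
  letters-∼ {π} {σ} eq = cong length eq , invariant (cong length eq , same eq (cong length eq))
    where
    lookup-cast : ∀ {xs ys : List ℕ} → xs ≡ ys → (e : length xs ≡ length ys) → ∀ i →
                  lookup xs i ≡ lookup ys (cast e i)
    lookup-cast {x ∷ xs} refl e Fin.zero    = refl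
    lookup-cast {x ∷ xs} refl e (Fin.suc i) = lookup-cast {xs} refl (ℕₚ.suc-injective e) i
    same : ∀ {xs ys : List ℕ} → xs ≡ ys → (e : length xs ≡ length ys) → ∀ i j →
           (lookup xs i < lookup xs j) ⇔ (lookup ys (cast e i) < lookup ys (cast e j))
    same eq e i j = mk⇔ (subst₂ _<_ (lookup-cast eq e i) (lookup-cast eq e j))
                        (subst₂ _<_ (sym (lookup-cast eq e i)) (sym (lookup-cast eq e j)))

  shift-∼ : ∀ n σ → σ ∼′ shift n σ
  shift-∼ n (permutation xs u p) = len , invariant (len , same)
    where
    len : length xs ≡ length (map (n ℕ.+_) xs)
    len = sym (length-map (n ℕ.+_) xs)
    lookup-shift : ∀ xs (e : length xs ≡ length (map (n ℕ.+_) xs)) i →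
                   n ℕ.+ lookup xs i ≡ lookup (map (n ℕ.+_) xs) (cast e i)
    lookup-shift (x ∷ xs) e Fin.zero    = refl
    lookup-shift (x ∷ xs) e (Fin.suc i) = lookup-shift xs (ℕₚ.suc-injective e) i
    same : ∀ i j → (lookup xs i < lookup xs j) ⇔
           (lookup (map (n ℕ.+_) xs) (cast len i) < lookup (map (n ℕ.+_) xs) (cast len j))
    same i j = mk⇔ (λ lt → subst₂ _<_ (lookup-shift xs len i) (lookup-shift xs len j) (ℕₚ.+-monoʳ-< n lt))
                   (λ lt → ℕₚ.+-cancelˡ-< n _ _
                             (subst₂ _<_ (sym (lookup-shift xs len i)) (sym (lookup-shift xs len j)) lt))

  -- A total version of ⟨_⟩ on lists, with junk value 𝟘.
  isPermutation? : ∀ xs → Dec (Unique xs × All (0 <_) xs)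
  isPermutation? xs = unique? ℕₚ._≟_ xs ×-dec All.all? (0 ℕₚ.<?_) xs

  ⟦_⟧ : List ℕ → Comb Permutation
  ⟦ xs ⟧ with isPermutation? xs
  ... | yes (u , p) = ⟨ permutation xs u p ⟩
  ... | no  _       = 𝟘

  ⟦letters⟧ : ∀ π → ⟨ π ⟩ ≈ ⟦ letters π ⟧
  ⟦letters⟧ π with isPermutation? (letters π)
  ... | yes _ = relation (class (letters-∼ {σ = permutation _ _ _} refl))
  ... | no ¬p = contradiction (distinct π , positive π) ¬p

  sum-letters : ∀ {f : Permutation → Comb Permutation} (k : List ℕ → Comb Permutation) {πs} →
                All (λ π → f π ≈ k (letters π)) πs → sum (map f πs) ≈ sum (map k (map letters πs))
  sum-letters k {πs} es = ≈-trans (sum-map-cong es) (≈-reflexive (cong sum (map-∘ πs)))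

  sum-shuffle : ∀ {f : Permutation → Comb Permutation} (k : List ℕ → Comb Permutation)
                π σ (disj : Disjoint (letters π) (letters σ)) →
                (∀ τ → letters τ ↭ letters π ++ letters σ → f τ ≈ k (letters τ)) →
                sum (map f (shuffle π σ disj)) ≈ sum (map k (letters π ⧢ letters σ))
  sum-shuffle {f} k π σ disj e =
    ≈-trans (sum-letters k (All.map (λ {τ} → e τ)
              (Allₚ.map⁻ (subst (All (_↭ letters π ++ letters σ)) (sym (letters-shuffle π σ disj))
                (All.map toPermutation (⧢-interleaving (letters π) (letters σ)))))))
            (≈-reflexive (cong (sum ∘ map k) (letters-shuffle π σ disj)))

  length-shuffle : ∀ π σ (disj : Disjoint (letters π) (letters σ)) →
                   All (λ τ → ∣ τ ∣ ≡ ∣ π ∣ ℕ.+ ∣ σ ∣) (shuffle π σ disj)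
  length-shuffle π σ disj =
    Allₚ.map⁻ (subst (All (λ τ → length τ ≡ ∣ π ∣ ℕ.+ ∣ σ ∣)) (sym (letters-shuffle π σ disj))
      (All.map (λ i → trans (↭-length (toPermutation i)) (length-++ (letters π)))
               (⧢-interleaving (letters π) (letters σ))))

  sum-st : ∀ n {πs σs} → All (λ π → ∣ π ∣ ≡ n) πs → All (λ σ → ∣ σ ∣ ≡ n) σs →
           map st πs ↭ map st σs → sum (map ⟨_⟩ πs) ≈ sum (map ⟨_⟩ σs)
  sum-st n {πs} {σs} ps qs perm with ↭-map-inv st perm
  ... | ρs , eq , πs↭ρs = ≈-trans (sum-↭ (map⁺ ⟨_⟩ πs↭ρs)) (pointwise (All-resp-↭ πs↭ρs ps) qs (sym eq))
    where
    pointwise : ∀ {ρs σs} → All (λ π → ∣ π ∣ ≡ n) ρs → All (λ σ → ∣ σ ∣ ≡ n) σs →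
                map st ρs ≡ map st σs → sum (map ⟨_⟩ ρs) ≈ sum (map ⟨_⟩ σs)
    pointwise []       []       eq = ≈-refl
    pointwise (p ∷ ps) (q ∷ qs) eq =
      ⊕-cong (relation (class (trans p (sym q) , ∷-injectiveˡ eq))) (pointwise ps qs (∷-injectiveʳ eq))

  module _ (wsc : WeaklyShuffleCompatible S) where

    -- The product may be computed from any representatives π′ ≪ σ′.
    product-independent : ∀ {π σ π′ σ′} → π ∼′ π′ → σ ∼′ σ′ → (π′≪σ′ : π′ ≪ σ′) →
                          product π σ ≈ sum (map ⟨_⟩ (shuffle π′ σ′ (≪⇒disjoint π′ σ′ π′≪σ′)))
    product-independent {π} {σ} {π′} {σ′} (l , s) (l′ , s′) π′≪σ′ =
      sum-st (∣ π′ ∣ ℕ.+ ∣ σ′ ∣)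
        (All.map (λ eq → trans eq (cong₂ ℕ._+_ l l″)) (length-shuffle π σ↑ (≪⇒disjoint π σ↑ (≪-shift-max π σ))))
        (length-shuffle π′ σ′ (≪⇒disjoint π′ σ′ π′≪σ′))
        (wsc {π} {π′} {σ↑} {σ′} (≪-shift-max π σ) π′≪σ′ l l″ s (trans (sym (proj₂ (shift-∼ _ σ))) s′))
      where
      σ↑ = shift (max 0 (letters π)) σ
      l″ : ∣ σ↑ ∣ ≡ ∣ σ′ ∣
      l″ = trans (sym (proj₁ (shift-∼ _ σ))) l′

    product-⧢ : ∀ {π σ π′ σ′} → π ∼′ π′ → σ ∼′ σ′ → π′ ≪ σ′ →
                product π σ ≈ sum (map ⟦_⟧ (letters π′ ⧢ letters σ′))
    product-⧢ {π} {σ} {π′} {σ′} e e′ lt =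
      ≈-trans (product-independent {π} {σ} {π′} {σ′} e e′ lt)
              (sum-shuffle ⟦_⟧ π′ σ′ (≪⇒disjoint π′ σ′ lt) (λ τ _ → ⟦letters⟧ τ))

    product-cong : ∀ {π π′ σ σ′} → π ∼′ π′ → σ ∼′ σ′ → product π σ ≈ product π′ σ′
    product-cong {π} {π′} {σ} {σ′} e e′ =
      product-independent {π} {σ} {π′} {shift (max 0 (letters π′)) σ′} e (let (p , q) = e′ ; (p′ , q′) = shift-∼ _ σ′ in trans p p′ , trans q q′)
                          (≪-shift-max π′ σ′)

    private
      linearˡ : ∀ ρ πs → extend (λ π → product π ρ) (sum (map ⟨_⟩ πs)) ≡ sum (map (λ π → product π ρ) πs)
      linearˡ ρ []       = refl
      linearˡ ρ (π ∷ πs) = cong (product π ρ ⊕_) (linearˡ ρ πs)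

      linearʳ : ∀ π ρs → extend (product π) (sum (map ⟨_⟩ ρs)) ≡ sum (map (product π) ρs)
      linearʳ π []       = refl
      linearʳ π (ρ ∷ ρs) = cong (product π ρ ⊕_) (linearʳ π ρs)

    product-assoc : ∀ π σ ρ → extend (λ τ → product τ ρ) (product π σ) ≈ extend (product π) (product σ ρ)
    product-assoc π σ ρ = ≈-trans left (≈-trans middle (≈-sym right))
      where
      σ′ = shift (max 0 (letters π)) σ
      top = max 0 (letters π ++ letters σ′)
      ρ′ = shift top ρ

      π≪σ′ : π ≪ σ′
      π≪σ′ = ≪-shift-max π σ

      below : ∀ {x} → x ≤ top → All (x <_) (letters ρ′)
      below x≤ = Allₚ.map⁺ (All.map (λ {s} 0<s → ℕₚ.≤-<-trans x≤ (ℕₚ.m<m+n _ 0<s)) (positive ρ))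

      both : All (λ x → All (x <_) (letters ρ′)) (letters π ++ letters σ′)
      both = All.map below (xs≤max 0 (letters π ++ letters σ′))

      π≪ρ′ : π ≪ ρ′
      π≪ρ′ = Allₚ.++⁻ˡ (letters π) both

      σ′≪ρ′ : σ′ ≪ ρ′
      σ′≪ρ′ = Allₚ.++⁻ʳ (letters π) both

      left : extend (λ τ → product τ ρ) (product π σ) ≈
             sum (map ⟦_⟧ (concatMap (_⧢ letters ρ′) (letters π ⧢ letters σ′)))
      left = ≈-trans (≈-reflexive (linearˡ ρ (shuffle π σ′ (≪⇒disjoint π σ′ π≪σ′))))
            (≈-trans (sum-shuffle (λ τ → sum (map ⟦_⟧ (τ ⧢ letters ρ′))) π σ′ (≪⇒disjoint π σ′ π≪σ′)
                       (λ τ τ↭ → product-⧢ {τ} {ρ} {τ} {ρ′} (∼-refl τ) (shift-∼ top ρ) (All-resp-↭ (↭-sym τ↭) both)))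
                     (≈-sym (sum-concatMap ⟦_⟧ (_⧢ letters ρ′) (letters π ⧢ letters σ′))))

      middle : sum (map ⟦_⟧ (concatMap (_⧢ letters ρ′) (letters π ⧢ letters σ′))) ≈
               sum (map ⟦_⟧ (concatMap (letters π ⧢_) (letters σ′ ⧢ letters ρ′)))
      middle = sum-↭ (map⁺ ⟦_⟧ (⧢-assoc (letters π) (letters σ′) (letters ρ′)))

      right : extend (product π) (product σ ρ) ≈
              sum (map ⟦_⟧ (concatMap (letters π ⧢_) (letters σ′ ⧢ letters ρ′)))
      right = ≈-trans (extend-cong Class (product π) (λ { (class {σ₁} {σ₂} e) → product-cong {π} {π} {σ₁} {σ₂} (∼-refl π) e })
                        (product-independent {σ} {ρ} {σ′} {ρ′} (shift-∼ _ σ) (shift-∼ top ρ) σ′≪ρ′))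
             (≈-trans (≈-reflexive (linearʳ π (shuffle σ′ ρ′ (≪⇒disjoint σ′ ρ′ σ′≪ρ′))))
             (≈-trans (sum-shuffle (λ τ → sum (map ⟦_⟧ (letters π ⧢ τ))) σ′ ρ′ (≪⇒disjoint σ′ ρ′ σ′≪ρ′)
                        (λ τ τ↭ → product-⧢ {π} {τ} {π} {τ} (∼-refl π) (∼-refl τ)
                          (All.zipWith (λ { (p , q) → All-resp-↭ (↭-sym τ↭) (Allₚ.++⁺ p q) }) (π≪σ′ , π≪ρ′))))
                      (≈-sym (sum-concatMap ⟦_⟧ (letters π ⧢_) (letters σ′ ⧢ letters ρ′)))))

    product-identityˡ : ∀ π → product empty π ≈ ⟨ π ⟩
    product-identityˡ π = ≈-trans (product-⧢ {empty} {π} {empty} {π} (∼-refl empty) (∼-refl π) [])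
                         (≈-trans (⊕-identityʳ _) (≈-sym (⟦letters⟧ π)))

    product-identityʳ : ∀ π → product π empty ≈ ⟨ π ⟩
    product-identityʳ π =
      ≈-trans (product-⧢ {π} {empty} {π} {empty} (∼-refl π) (∼-refl empty) (All.tabulate (λ _ → [])))
     (≈-trans (≈-reflexive (cong (sum ∘ map ⟦_⟧) (⧢-[]ʳ (letters π))))
     (≈-trans (⊕-identityʳ _) (≈-sym (⟦letters⟧ π))))

    product-length : ∀ {m n π σ} → Length m π → Length n σ → Span (Length (m ℕ.+ n)) (product π σ)
    product-length {π = π} {σ} refl refl = span-sum (Allₚ.map⁺ (All.map
      (λ eq → generator (trans eq (cong (∣ π ∣ ℕ.+_) (sym (proj₁ (shift-∼ _ σ))))))
      (length-shuffle π σ′ (≪⇒disjoint π σ′ (≪-shift-max π σ)))))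
      where σ′ = shift (max 0 (letters π)) σ

    projection-resp : ∀ n {x y} → Class x y → extend (projection n) x ≈ extend (projection n) y
    projection-resp n (class {π} {σ} e) with ∣ π ∣ ℕₚ.≟ n | ∣ σ ∣ ℕₚ.≟ n
    ... | yes _ | yes _ = relation (class {π} {σ} e)
    ... | yes p | no q  = contradiction (trans (sym (proj₁ e)) p) q
    ... | no p  | yes q = contradiction (trans (proj₁ e) q) p
    ... | no _  | no _  = ≈-refl

    projection-same : ∀ {n π} → Length n π → projection n π ≈ ⟨ π ⟩
    projection-same {n} {π} eq with ∣ π ∣ ℕₚ.≟ n
    ... | yes _ = ≈-refl
    ... | no ne = contradiction eq ne

    projection-other : ∀ {m n π} → m ≢ n → Length m π → projection n π ≈ 𝟘
    projection-other {n = n} {π} ne refl with ∣ π ∣ ℕₚ.≟ n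
    ... | yes eq = contradiction eq ne
    ... | no _   = ≈-refl

    gradedProduct : GradedProduct Class Length
    gradedProduct = record
      { μ = product
      ; e = empty
      ; κ = projection
      ; μ-respˡ = λ { ρ (class {π} {σ} e) → product-cong {π} {σ} {ρ} {ρ} e (∼-refl ρ) }
      ; μ-respʳ = λ { ρ (class {π} {σ} e) → product-cong {ρ} {ρ} {π} {σ} (∼-refl ρ) e }
      ; μ-assoc = product-assoc
      ; μ-identityˡ = product-identityˡ
      ; μ-identityʳ = product-identityʳ
      ; e-deg = refl
      ; μ-deg = λ {m} {n} {π} {σ} → product-length {m} {n} {π} {σ}
      ; spans = λ π → [ ⟨ π ⟩ ] , (∣ π ∣ , generator refl) ∷ [] , ≈-sym (⊕-identityʳ _)
      ; κ-resp = projection-resp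
      ; κ-same = projection-same
      ; κ-other = projection-other
      }

𝒜 : {V : Set v} (S : Statistic V) → WeaklyShuffleCompatible S → GradedAlgebra 0ℓ v v
𝒜 S wsc = GradedProduct.gradedAlgebra (ShuffleAlgebra.gradedProduct S wsc)

-- ⟨ ⟨ π ⟩ , ⟨ σ ⟩ ⟩ is [π] ⊗ [σ]; compatibility with the relations that define
-- the classes and the tensor product is part of being a homomorphism.
Δ : Comb Permutation → Comb (Comb Permutation × Comb Permutation)
Δ = extend λ π → sum (map (λ i → ⟨ ⟨ prefix i π ⟩ , ⟨ suffix i π ⟩ ⟩) (upTo (suc ∣ π ∣)))

{-# OPTIONS --safe #-}

-- Cutting a shuffle τ of π and σ into a prefix and a suffix cuts π = ab and
-- σ = cd so that the prefix of τ is a shuffle of a and c, and its suffix a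
-- shuffle of b and d; conversely every such pair arises exactly once.  Summing
-- over all (τ, cut), the two sides of Δ([π][σ]) = Δ[π] Δ[σ] agree term by term.
-- Substring-compatibility makes Δ well defined on classes, and weak
-- shuffle-compatibility lets all products be computed from substrings of one
-- fixed pair of representatives π ≪ σ.
module Submission where

open import Defs
open import Algebra.Bundles.Raw using (RawRing)
open import Algebra.Morphism.Structures using (module MonoidMorphisms)
open import Data.List.Base using (List; []; _∷_; _++_; map; foldr; length; take; drop; upTo; applyUpTo)
open import Data.List.Properties using (map-++; map-∘; map-upTo; take++drop≡id; length-++; take-all; drop-all)
open import Data.List.Relation.Binary.Disjoint.Propositional using (Disjoint)
open import Data.List.Relation.Unary.All as All using ()
import Data.List.Relation.Unary.All.Properties as Allₚ
open import Data.List.Extrema.Nat using (max)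
open import Data.Nat.Base using (ℕ; zero; suc; _≤_; s≤s; z≤n)
import Data.Nat.Properties as ℕₚ
open import Data.Product.Base using (_×_; _,_; proj₁; proj₂)
open import Function.Base using (_∘_)
open import Level using (Level; _⊔_)
open import Relation.Binary.Bundles using (Setoid)
open import Relation.Binary.Core using (Rel)
open import Relation.Binary.PropositionalEquality using (_≡_; refl; sym; trans; cong; cong₂)
open import Relation.Nullary using (yes; no)
import Relation.Binary.Reasoning.Setoid as SetoidReasoning

private
  variable
    a g h r v : Level

extend-sum : {G : Set g} {H : Set h} {I : Set a} (f : G → Comb H) (k : I → Comb G) (is : List I) →
             extend f (sum (map k is)) ≡ sum (map (extend f ∘ k) is)
extend-sum f k []       = refl
extend-sum f k (i ∷ is) = cong (extend f (k i) ⊕_) (extend-sum f k is)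

-- Sums over shuffles and over cuts of words.

module Cuts {G : Set g} (R : Rel (Comb G) r) where
  open Presented R

  setoid : Setoid g (g ⊔ r)
  setoid = record
    { Carrier = Comb G ; _≈_ = _≈_ ; isEquivalence = record { refl = ≈-refl ; sym = ≈-sym ; trans = ≈-trans } }

  open SetoidReasoning setoid

  ∑ : {I : Set a} → List I → (I → Comb G) → Comb G
  ∑ is f = sum (map f is)

  ∑-ext : {I : Set a} (is : List I) {f f′ : I → Comb G} → (∀ i → f i ≈ f′ i) → ∑ is f ≈ ∑ is f′
  ∑-ext is e = sum-map-cong (All.universal e is)

  ∑-⊕ : {I : Set a} (is : List I) (f f′ : I → Comb G) → ∑ is (λ i → f i ⊕ f′ i) ≈ ∑ is f ⊕ ∑ is f′
  ∑-⊕ []       f f′ = ≈-sym (⊕-identityˡ 𝟘)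
  ∑-⊕ (i ∷ is) f f′ = ≈-trans (⊕-cong ≈-refl (∑-⊕ is f f′)) (interchange _ _ _ _)

  ∑-⧢-∷ : ∀ (f : List ℕ → Comb G) x xs y ys →
          ∑ ((x ∷ xs) ⧢ (y ∷ ys)) f ≈ ∑ (xs ⧢ (y ∷ ys)) (f ∘ (x ∷_)) ⊕ ∑ ((x ∷ xs) ⧢ ys) (f ∘ (y ∷_))
  ∑-⧢-∷ f x xs y ys = begin
    sum (map f (map (x ∷_) S ++ map (y ∷_) T))           ≡⟨ cong sum (map-++ f (map (x ∷_) S) _) ⟩
    sum (map f (map (x ∷_) S) ++ map f (map (y ∷_) T))   ≈⟨ sum-++ (map f (map (x ∷_) S)) _ ⟩
    sum (map f (map (x ∷_) S)) ⊕ sum (map f (map (y ∷_) T))   ≡⟨ cong₂ _⊕_ (cong sum (map-∘ S)) (cong sum (map-∘ T)) ⟨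
    ∑ S (f ∘ (x ∷_)) ⊕ ∑ T (f ∘ (y ∷_))                       ∎
    where
    S = xs ⧢ (y ∷ ys)
    T = (x ∷ xs) ⧢ ys

  -- The sum of f a b over all factorisations of a list as a ++ b.
  ∑cuts : (List ℕ → List ℕ → Comb G) → List ℕ → Comb G
  ∑cuts f []       = f [] [] ⊕ 𝟘
  ∑cuts f (x ∷ xs) = f [] (x ∷ xs) ⊕ ∑cuts (f ∘ (x ∷_)) xs

  -- Replaces the indexed sum that occurs in `Δ` by a recursion on the word. Propositional equality
  -- is possible because `∑cuts` keeps the trailing `𝟘` that `sum` produces.
  ∑cuts-upTo : ∀ f xs → ∑ (upTo (suc (length xs))) (λ i → f (take i xs) (drop i xs)) ≡ ∑cuts f xs
  ∑cuts-upTo f xs = trans (cong sum (map-upTo _ (suc (length xs)))) (go f xs)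
    where
    go : ∀ f xs → sum (applyUpTo (λ i → f (take i xs) (drop i xs)) (suc (length xs))) ≡ ∑cuts f xs
    go f []       = refl
    go f (x ∷ xs) = cong (f [] (x ∷ xs) ⊕_) (go (f ∘ (x ∷_)) xs)

  ∑cuts-ext : ∀ {f f′} → (∀ a b → f a b ≈ f′ a b) → ∀ xs → ∑cuts f xs ≈ ∑cuts f′ xs
  ∑cuts-ext e []       = ⊕-cong (e [] []) ≈-refl
  ∑cuts-ext e (x ∷ xs) = ⊕-cong (e [] (x ∷ xs)) (∑cuts-ext (λ a b → e (x ∷ a) b) xs)

  ∑cuts-⊕ : ∀ f f′ xs → ∑cuts (λ a b → f a b ⊕ f′ a b) xs ≈ ∑cuts f xs ⊕ ∑cuts f′ xs
  ∑cuts-⊕ f f′ []       = ≈-trans (⊕-cong ≈-refl (≈-sym (⊕-identityˡ 𝟘))) (interchange _ _ _ _)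
  ∑cuts-⊕ f f′ (x ∷ xs) = ≈-trans (⊕-cong ≈-refl (∑cuts-⊕ _ _ xs)) (interchange _ _ _ _)

  -- The arguments are grouped by word: `a`, `b` come from cutting the first word and `c`, `d` from
  -- cutting the second, so that `∑⧢×⧢ f a b` can be summed over cuts by `∑cuts`.
  ∑⧢×⧢ : (List ℕ → List ℕ → Comb G) → (a b c d : List ℕ) → Comb G
  ∑⧢×⧢ f a b c d = ∑ (a ⧢ c) λ s → ∑ (b ⧢ d) (f s)

  -- A nonempty prefix of a shuffle starts with the first letter of one of the two words; removing
  -- that letter leaves a smaller instance. Since the letter is then absorbed into `f`, the
  -- induction needs arbitrary `f`.
  ∑cuts-⧢ : ∀ f xs ys →
            ∑ (xs ⧢ ys) (∑cuts f) ≈ ∑cuts (λ a b → ∑cuts (λ c d → ∑⧢×⧢ f a b c d) ys) xs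
  ∑cuts-⧢ f [] ys = ⊕-cong
    (∑cuts-ext (λ c d → ≈-sym (≈-trans (⊕-identityʳ _) (⊕-identityʳ _))) ys) ≈-refl
  ∑cuts-⧢ f (x ∷ xs) [] = ≈-trans (⊕-identityʳ _) (∑cuts-ext single (x ∷ xs))
    where
    single : ∀ a b → f a b ≈ ∑⧢×⧢ f a b [] [] ⊕ 𝟘
    single a b rewrite ⧢-[]ʳ a | ⧢-[]ʳ b =
      ≈-sym (≈-trans (⊕-identityʳ _) (≈-trans (⊕-identityʳ _) (⊕-identityʳ _)))
  ∑cuts-⧢ f (x ∷ xs) (y ∷ ys) = begin
    ∑ (X ⧢ Y) (∑cuts f)
      ≈⟨ ∑-⧢-∷ (∑cuts f) x xs y ys ⟩
    ∑ (xs ⧢ Y) (λ τ → f [] (x ∷ τ) ⊕ ∑cuts fx τ) ⊕ ∑ (X ⧢ ys) (λ τ → f [] (y ∷ τ) ⊕ ∑cuts fy τ)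
      ≈⟨ ⊕-cong (∑-⊕ (xs ⧢ Y) _ _) (∑-⊕ (X ⧢ ys) _ _) ⟩
    (∑ (xs ⧢ Y) (λ τ → f [] (x ∷ τ)) ⊕ ∑ (xs ⧢ Y) (∑cuts fx)) ⊕
    (∑ (X ⧢ ys) (λ τ → f [] (y ∷ τ)) ⊕ ∑ (X ⧢ ys) (∑cuts fy))
      ≈⟨ interchange _ _ _ _ ⟩
    (∑ (xs ⧢ Y) (λ τ → f [] (x ∷ τ)) ⊕ ∑ (X ⧢ ys) (λ τ → f [] (y ∷ τ))) ⊕
    (∑ (xs ⧢ Y) (∑cuts fx) ⊕ ∑ (X ⧢ ys) (∑cuts fy))
      -- The terms with empty prefix recombine into one sum over `X ⧢ Y`. The second induction
      -- hypothesis unfolds into the cut of `X` with empty first part and the cuts after `x`.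
      ≈⟨ ⊕-cong (≈-sym (∑-⧢-∷ (f []) x xs y ys)) (⊕-cong (∑cuts-⧢ fx xs (y ∷ ys)) (∑cuts-⧢ fy (x ∷ xs) ys)) ⟩
    ∑ (X ⧢ Y) (f []) ⊕
    (∑cuts (λ a b → ∑cuts (∑⧢×⧢ fx a b) Y) xs ⊕
     (∑cuts (∑⧢×⧢ fy [] X) ys ⊕ ∑cuts (λ a b → ∑cuts (∑⧢×⧢ fy (x ∷ a) b) ys) xs))
      ≈⟨ rearrange _ _ _ _ ⟩
    (∑ (X ⧢ Y) (f []) ⊕ ∑cuts (∑⧢×⧢ fy [] X) ys) ⊕
    (∑cuts (λ a b → ∑cuts (∑⧢×⧢ fx a b) Y) xs ⊕ ∑cuts (λ a b → ∑cuts (∑⧢×⧢ fy (x ∷ a) b) ys) xs)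
      -- The added `𝟘` ends the one-term sum over `[] ⧢ []`. Beyond it, `∑⧢×⧢ f [] X (y ∷ c) d`
      -- computes to the same sum as `∑⧢×⧢ fy [] X c d`.
      ≈⟨ ⊕-cong (⊕-cong (≈-sym (⊕-identityʳ _)) ≈-refl) (≈-sym (∑cuts-⊕ _ _ xs)) ⟩
    ∑cuts (∑⧢×⧢ f [] X) Y ⊕
    ∑cuts (λ a b → ∑cuts (∑⧢×⧢ fx a b) Y ⊕ ∑cuts (∑⧢×⧢ fy (x ∷ a) b) ys) xs
      ≈⟨ ⊕-cong ≈-refl (∑cuts-ext (λ a b → ≈-sym (first-letter a b)) xs) ⟩
    ∑cuts (∑⧢×⧢ f [] X) Y ⊕ ∑cuts (λ a b → ∑cuts (∑⧢×⧢ f (x ∷ a) b) Y) xs ∎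
    where
    X = x ∷ xs
    Y = y ∷ ys
    fx = f ∘ (x ∷_)
    fy = f ∘ (y ∷_)

    rearrange : ∀ p q s t → p ⊕ (q ⊕ (s ⊕ t)) ≈ (p ⊕ s) ⊕ (q ⊕ t)
    rearrange p q s t = ≈-trans (≈-sym (⊕-assoc p q _)) (interchange p q s t)

    -- If the prefix takes nothing from `Y`, it must start with `x`, which accounts for the first
    -- term; otherwise it starts with `x` or `y`.
    first-letter : ∀ a b → ∑cuts (∑⧢×⧢ f (x ∷ a) b) Y ≈
                           ∑cuts (∑⧢×⧢ fx a b) Y ⊕ ∑cuts (∑⧢×⧢ fy (x ∷ a) b) ys
    first-letter a b = begin
      ∑⧢×⧢ f (x ∷ a) b [] Y ⊕ ∑cuts (λ c d → ∑⧢×⧢ f (x ∷ a) b (y ∷ c) d) ys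
        ≈⟨ ⊕-cong (≈-reflexive (cong (λ S → ∑ S (λ s → ∑ (b ⧢ Y) (fx s))) (sym (⧢-[]ʳ a))))
                  (≈-trans (∑cuts-ext (λ c d → ∑-⧢-∷ (λ s → ∑ (b ⧢ d) (f s)) x a y c) ys) (∑cuts-⊕ _ _ ys)) ⟩
      ∑⧢×⧢ fx a b [] Y ⊕ (∑cuts (λ c d → ∑⧢×⧢ fx a b (y ∷ c) d) ys ⊕ ∑cuts (∑⧢×⧢ fy (x ∷ a) b) ys)
        ≈⟨ ≈-sym (⊕-assoc _ _ _) ⟩
      ∑cuts (∑⧢×⧢ fx a b) Y ⊕ ∑cuts (∑⧢×⧢ fy (x ∷ a) b) ys ∎

-- Bilinear expansion of pure tensors.

module TensorSums {c₁ ℓ₁ h₁ c₂ ℓ₂ h₂} (A : GradedAlgebra c₁ ℓ₁ h₁) (B : GradedAlgebra c₂ ℓ₂ h₂) where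
  private
    module A = GradedAlgebra A
    module B = GradedAlgebra B
  open Tensor A B
  open Presented Bilinear
  open Cuts Bilinear using (∑)

  ⊗-∑ʳ : {J : Set a} (x : A.Carrier) (k : J → B.Carrier) (js : List J) →
         ⟨ x , foldr B._+_ B.0# (map k js) ⟩ ≈ ∑ js (λ j → ⟨ x , k j ⟩)
  ⊗-∑ʳ x k []       = ⊗-zeroʳ x
  ⊗-∑ʳ x k (j ∷ js) = ≈-trans (relation (⊗-distribˡ x (k j) _)) (⊕-cong ≈-refl (⊗-∑ʳ x k js))

  ⊗-∑ : {I : Set a} {J : Set h} (f : I → A.Carrier) (k : J → B.Carrier) (is : List I) (js : List J) →
        ⟨ foldr A._+_ A.0# (map f is) , foldr B._+_ B.0# (map k js) ⟩ ≈ ∑ is (λ i → ∑ js (λ j → ⟨ f i , k j ⟩))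
  ⊗-∑ f k []       js = ⊗-zeroˡ _
  ⊗-∑ f k (i ∷ is) js = ≈-trans (relation (⊗-distribʳ (f i) _ _)) (⊕-cong (⊗-∑ʳ (f i) k js) (⊗-∑ f k is js))

-- Compatibility of `Δ` with classes, products and degrees.

module SubstringCoalgebra {V : Set v} (S : Statistic V) (bicompatible : WeaklyBicompatible S) where
  private
    wsc = proj₁ bicompatible
    sc  = proj₂ bicompatible
    A   = 𝒜 S wsc
    module A = GradedAlgebra A
    module A⊗A = GradedAlgebra (A ⊗ A)

  open ShuffleAlgebra S
  open Tensor A A
  open Presented Bilinear
  open Cuts Bilinear
  open TensorSums A A
  open SetoidReasoning setoid

  private
    infix 4 _∼′_
    _∼′_ : Rel Permutation v
    _∼′_ = _∼_ S

    ∼-trans : ∀ {π σ τ} → π ∼′ σ → σ ∼′ τ → π ∼′ τ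
    ∼-trans (p , q) (p′ , q′) = trans p p′ , trans q q′

  -- Substring-compatibility speaks of nonempty substrings only, so the empty prefix is treated
  -- apart.
  prefix-∼ : ∀ {π σ} → π ∼′ σ → ∀ i → i ≤ ∣ π ∣ → prefix i π ∼′ prefix i σ
  prefix-∼ {π} {σ} e zero    _   = letters-∼ {prefix 0 π} {prefix 0 σ} refl
  prefix-∼ {π} {σ} e (suc i) i<n = sc {π} {σ} e 1 (suc i) (s≤s z≤n) (s≤s z≤n) i<n

  -- The exceptional empty suffix is now at `i` equal to the length. Any other suffix has the
  -- letters of `substring (suc i) n`, after removal of a `take n` that keeps everything.
  suffix-∼ : ∀ {π σ} → π ∼′ σ → ∀ i → i ≤ ∣ π ∣ → suffix i π ∼′ suffix i σ
  suffix-∼ {π} {σ} e i i≤n with i ℕₚ.≟ ∣ π ∣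
  ... | yes refl = letters-∼ {suffix i π} {suffix i σ}
                     (trans (drop-all i (letters π) ℕₚ.≤-refl)
                            (sym (drop-all i (letters σ) (ℕₚ.≤-reflexive (sym (proj₁ e))))))
  ... | no i≢n   =
    ∼-trans {suffix i π} {substring (suc i) n π} {suffix i σ}
      (letters-∼ {suffix i π} {substring (suc i) n π} (cong (drop i) (sym (take-all n (letters π) ℕₚ.≤-refl))))
   (∼-trans {substring (suc i) n π} {substring (suc i) n σ} {suffix i σ}
      (sc {π} {σ} e (suc i) n (s≤s z≤n) (ℕₚ.≤∧≢⇒< i≤n i≢n) ℕₚ.≤-refl)
      (letters-∼ {substring (suc i) n σ} {suffix i σ}
        (cong (drop i) (take-all n (letters σ) (ℕₚ.≤-reflexive (sym (proj₁ e)))))))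
    where n = ∣ π ∣

  Δ-∼ : ∀ {π σ} → π ∼′ σ → Δ ⟨ π ⟩ ≈ Δ ⟨ σ ⟩
  Δ-∼ {π} {σ} e = ≈-trans (sum-map-cong (All.map
    (λ { {i} (s≤s i≤n) → relation (⊗-cong
           (Presented.relation (class {prefix i π} {prefix i σ} (prefix-∼ {π} {σ} e i i≤n)))
           (Presented.relation (class {suffix i π} {suffix i σ} (suffix-∼ {π} {σ} e i i≤n)))) })
    (Allₚ.all-upTo (suc ∣ π ∣))))
    (≈-reflexive (cong (λ n → ∑ (upTo (suc n)) (λ i → ⟨ ⟨ prefix i σ ⟩ , ⟨ suffix i σ ⟩ ⟩)) (proj₁ e)))

  Δ-cong : ∀ {x y} → x A.≈ y → Δ x ≈ Δ y
  Δ-cong = extend-cong Bilinear _ λ { (class {π} {σ} e) → Δ-∼ {π} {σ} e }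

  -- Passing to `⟦_⟧` makes each term a function of bare words, as `∑cuts` requires. Pieces of a
  -- permutation are permutations, so the junk value never occurs here.
  Δ-cuts : ∀ π → Δ ⟨ π ⟩ ≈ ∑cuts (λ a b → ⟨ ⟦ a ⟧ , ⟦ b ⟧ ⟩) (letters π)
  Δ-cuts π = ≈-trans
    (∑-ext (upTo (suc ∣ π ∣)) λ i → relation (⊗-cong (⟦letters⟧ (prefix i π)) (⟦letters⟧ (suffix i π))))
    (≈-reflexive (∑cuts-upTo _ (letters π)))

  ∑-shuffle : ∀ (k : List ℕ → Comb (A.Carrier × A.Carrier)) π σ (disj : Disjoint (letters π) (letters σ)) →
              ∑ (shuffle π σ disj) (k ∘ letters) ≡ ∑ (letters π ⧢ letters σ) k
  ∑-shuffle k π σ disj = cong sum (trans (map-∘ (shuffle π σ disj)) (cong (map k) (letters-shuffle π σ disj)))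

  ≪-prefix : ∀ {π σ} → π ≪ σ → ∀ i j → prefix i π ≪ prefix j σ
  ≪-prefix π≪σ i j = Allₚ.take⁺ i (All.map (Allₚ.take⁺ j) π≪σ)

  ≪-suffix : ∀ {π σ} → π ≪ σ → ∀ i j → suffix i π ≪ suffix j σ
  ≪-suffix π≪σ i j = Allₚ.drop⁺ i (All.map (Allₚ.drop⁺ j) π≪σ)

  Δ*Δ-cuts : ∀ {π σ} → π ≪ σ →
             Δ ⟨ π ⟩ A⊗A.* Δ ⟨ σ ⟩ ≈
             ∑cuts (λ a b → ∑cuts (∑⧢×⧢ (λ s t → ⟨ ⟦ s ⟧ , ⟦ t ⟧ ⟩) a b) (letters σ)) (letters π)
  Δ*Δ-cuts {π} {σ} π≪σ = begin
    Δ ⟨ π ⟩ A⊗A.* Δ ⟨ σ ⟩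
      ≡⟨ extend-sum _ _ I ⟩
    ∑ I (λ i → ⟨ ⟨ prefix i π ⟩ , ⟨ suffix i π ⟩ ⟩ A⊗A.* Δ ⟨ σ ⟩)
      ≈⟨ ∑-ext I (λ i → ≈-reflexive (extend-sum _ _ J)) ⟩
    ∑ I (λ i → ∑ J λ j → ⟨ product (prefix i π) (prefix j σ) , product (suffix i π) (suffix j σ) ⟩)
      -- `product` shifts its right factor by an amount depending on the left one. As `π ≪ σ` passes
      -- to the pieces, weak shuffle-compatibility allows shuffling the pieces themselves.
      ≈⟨ ∑-ext I (λ i → ∑-ext J λ j → relation (⊗-cong
           (product≈ (prefix i π) (prefix j σ) (≪-prefix {π} {σ} π≪σ i j))
           (product≈ (suffix i π) (suffix j σ) (≪-suffix {π} {σ} π≪σ i j)))) ⟩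
    ∑ I (λ i → ∑ J λ j →
      ⟨ sum (map ⟦_⟧ (letters (prefix i π) ⧢ letters (prefix j σ)))
      , sum (map ⟦_⟧ (letters (suffix i π) ⧢ letters (suffix j σ))) ⟩)
      ≈⟨ ∑-ext I (λ i → ∑-ext J λ j → ⊗-∑ ⟦_⟧ ⟦_⟧
           (letters (prefix i π) ⧢ letters (prefix j σ)) (letters (suffix i π) ⧢ letters (suffix j σ))) ⟩
    ∑ I (λ i → ∑ J λ j → F (letters (prefix i π)) (letters (suffix i π)) (letters (prefix j σ)) (letters (suffix j σ)))
      ≈⟨ ∑-ext I (λ i → ≈-reflexive (∑cuts-upTo (F (letters (prefix i π)) (letters (suffix i π))) (letters σ))) ⟩
    ∑ I (λ i → ∑cuts (F (letters (prefix i π)) (letters (suffix i π))) (letters σ))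
      ≡⟨ ∑cuts-upTo (λ a b → ∑cuts (F a b) (letters σ)) (letters π) ⟩
    ∑cuts (λ a b → ∑cuts (F a b) (letters σ)) (letters π) ∎
    where
    I = upTo (suc ∣ π ∣)
    J = upTo (suc ∣ σ ∣)
    F = ∑⧢×⧢ (λ s t → ⟨ ⟦ s ⟧ , ⟦ t ⟧ ⟩)
    product≈ : ∀ α β → α ≪ β → product α β A.≈ sum (map ⟦_⟧ (letters α ⧢ letters β))
    product≈ α β = product-⧢ wsc {α} {β} {α} {β} (refl , refl) (refl , refl)

  Δ-product : ∀ π σ → Δ (product π σ) ≈ Δ ⟨ π ⟩ A⊗A.* Δ ⟨ σ ⟩
  Δ-product π σ = begin
    Δ (product π σ)
      ≡⟨ extend-sum _ ⟨_⟩ (shuffle π σ′ disj) ⟩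
    ∑ (shuffle π σ′ disj) (λ τ → Δ ⟨ τ ⟩)
      ≈⟨ ∑-ext (shuffle π σ′ disj) Δ-cuts ⟩
    ∑ (shuffle π σ′ disj) (∑cuts f ∘ letters)
      ≡⟨ ∑-shuffle (∑cuts f) π σ′ disj ⟩
    ∑ (letters π ⧢ letters σ′) (∑cuts f)
      ≈⟨ ∑cuts-⧢ f (letters π) (letters σ′) ⟩
    ∑cuts (λ a b → ∑cuts (∑⧢×⧢ f a b) (letters σ′)) (letters π)
      ≈⟨ Δ*Δ-cuts {π} {σ′} π≪σ′ ⟨
    Δ ⟨ π ⟩ A⊗A.* Δ ⟨ σ′ ⟩
      -- Shifting keeps the relative order, so `σ` and `σ′` lie in one class, on which `Δ` is
      -- constant.
      ≈⟨ A⊗A.*-cong {Δ ⟨ π ⟩} ≈-refl (Δ-∼ {σ} {σ′} (shift-∼ _ σ)) ⟨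
    Δ ⟨ π ⟩ A⊗A.* Δ ⟨ σ ⟩ ∎
    where
    σ′ = shift (max 0 (letters π)) σ
    π≪σ′ = ≪-shift-max π σ
    disj = ≪⇒disjoint π σ′ π≪σ′
    f : List ℕ → List ℕ → Comb (A.Carrier × A.Carrier)
    f s t = ⟨ ⟦ s ⟧ , ⟦ t ⟧ ⟩

  -- Bilinearity reduces this to generators. Products recurse on the left factor, so linearity there
  -- is computation; on the right, the laws of the tensor algebra are needed.
  Δ-* : ∀ x y → Δ (x A.* y) ≈ Δ x A⊗A.* Δ y
  Δ-* 𝟘        y = ≈-refl
  Δ-* (x ⊕ x′) y = ⊕-cong (Δ-* x y) (Δ-* x′ y)
  Δ-* (q · x)  y = ·-cong q (Δ-* x y)
  Δ-* ⟨ π ⟩    y = right y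
    where
    right : ∀ y → Δ (⟨ π ⟩ A.* y) ≈ Δ ⟨ π ⟩ A⊗A.* Δ y
    right 𝟘        = ≈-sym (A⊗A.zeroʳ (Δ ⟨ π ⟩))
    right (y ⊕ y′) = ≈-trans (⊕-cong (right y) (right y′)) (≈-sym (A⊗A.distribˡ (Δ ⟨ π ⟩) (Δ y) (Δ y′)))
    right (q · y)  = ≈-trans (·-cong q (right y)) (≈-sym (A⊗A.*-·-assocʳ q (Δ ⟨ π ⟩) (Δ y)))
    right ⟨ σ ⟩    = Δ-product π σ

  -- On a generator, the two pieces of every cut have lengths adding up to that of `π`.
  Δ-homogeneous : ∀ {n x} → A.Homogeneous n x → A⊗A.Homogeneous n (Δ x)
  Δ-homogeneous (Presented.generator {π} refl) = span-sum (Allₚ.map⁺ (All.universal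
    (λ i → generator (∣ prefix i π ∣ , ∣ suffix i π ∣
                     , trans (sym (length-++ (take i (letters π)))) (cong length (take++drop≡id i (letters π)))
                     , Presented.generator refl , Presented.generator refl))
    (upTo (suc ∣ π ∣))))
  Δ-homogeneous Presented.zero        = zero
  Δ-homogeneous (Presented.add s t)   = add (Δ-homogeneous s) (Δ-homogeneous t)
  Δ-homogeneous (Presented.scale q s) = scale q (Δ-homogeneous s)
  Δ-homogeneous (Presented.resp e s)  = resp (Δ-cong e) (Δ-homogeneous s)

-- `Δ` as a homomorphism of graded algebras.

proposition3p15 : ∀ {v : Level} {V : Set v} (st : Statistic V) (bicompatible : WeaklyBicompatible st) →
    let A = 𝒜 st (proj₁ bicompatible) in IsGradedAlgebraHomomorphism A (A ⊗ A) Δ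
proposition3p15 st bicompatible = record
  { isRingHomomorphism = record
    { isSemiringHomomorphism = record
      { isNearSemiringHomomorphism = record
        { +-isMonoidHomomorphism = +-isMonoidHomomorphism
        ; *-homo = Δ-* }
      -- The empty permutation has a single cut, so its image is the unit followed by the closing
      -- `𝟘` of `sum`.
      ; 1#-homo = ⊕-identityʳ _ }
    ; -‿homo = λ _ → ≈-refl }
  ; isLeftModuleHomomorphism = record
    { +ᴹ-isGroupHomomorphism = record
      { isMonoidHomomorphism = +-isMonoidHomomorphism
      ; ⁻¹-homo = λ _ → ≈-refl }
    ; *ₗ-homo = λ _ _ → ≈-refl }
  ; homogeneous-homo = Δ-homogeneous
  }
  where
  open SubstringCoalgebra st bicompatible
  A = 𝒜 st (proj₁ bicompatible)
  module A = GradedAlgebra A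
  module A⊗A = GradedAlgebra (A ⊗ A)
  open Presented (Tensor.Bilinear A A)
  +-isMonoidHomomorphism : MonoidMorphisms.IsMonoidHomomorphism
                             (RawRing.+-rawMonoid A.rawRing) (RawRing.+-rawMonoid A⊗A.rawRing) Δ
  +-isMonoidHomomorphism = record
    { isMagmaHomomorphism = record
      { isRelHomomorphism = record { cong = Δ-cong }
      ; homo = λ _ _ → ≈-refl }
    ; ε-homo = ≈-refl }
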